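{- Let $m_0,m_1\in\mathbb{Q}$ and let $(m_n)_{n\ge0}$ be the sequence of rational numbers determined by $m_0,m_1$ and the recurrence \[(n+2)m_n=(2n+1)m_{n-1}+(3n-3)m_{n-2}\quad (n\ge 2).\] Let $M(x)=\sum_{n\ge0} m_n x^n$. The following statements are equivalent: (1) $M(x)$ is algebraic; (2) $M(x)$ is globally bounded; (3) there exists $b\in\mathbb{Z}\setminus\{0\}$ such that $m_n\in\frac{1}{b}\mathbb{Z}$ for all $n\ge0$; (4) $m_0=m_1$; (5) $M(x)$ is the diagonal of some bivariate rational function.
   Context: A power series $f\in\mathbb{Q}[[x]]$ is algebraic if it is algebraic over $\mathbb{Q}(x)$. A power series $f(x)=\sum_{n\ge0}a_nx^n\in\mathbb{Q}[[x]]$ is almost integral if there exists $C\in\mathbb{Z}\setminus\{0\}$ with $C^na_n\in\mathbb{Z}$ for all $n\ge1$; it is globally bounded if it is almost integral and has a nonzero radius of convergence in $\mathbb{C}$. The diagonal of $R=\sum_{n_1,n_2\ge0}c(n_1,n_2)x_1^{n_1}x_2^{n_2}\in\mathbb{Q}[[x_1,x_2]]$ is $\sum_{n\ge0}c(n,n)t^n$; "diagonal of a bivariate rational function" means the diagonal of a rational function in $\mathbb{Q}(x_1,x_2)$ that admits a power series expansion in $\mathbb{Q}[[x_1,x_2]]$. -}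

module Defs where

open import Data.Nat as ℕ using (ℕ; zero; suc; _∸_)
open import Data.Integer as ℤ using (ℤ; +_)
open import Data.Rational using (ℚ; 0ℚ; 1ℚ; _+_; _*_; _/_; ∣_∣; _≤_)
open import Data.List using (List; []; _∷_)
open import Data.List.Relation.Unary.Any using (Any)
open import Data.Product using (Σ; _×_; ∃)
open import Relation.Binary.PropositionalEquality using (_≡_; _≢_)

PowerSeries : Set
PowerSeries = ℕ → ℚ

PowerSeries₂ : Set
PowerSeries₂ = ℕ → ℕ → ℚ

sumTo : (ℕ → ℚ) → ℕ → ℚ
sumTo f zero    = f zero
sumTo f (suc n) = sumTo f n + f (suc n)

pow : ℚ → ℕ → ℚ
pow q zero    = 1ℚ
pow q (suc n) = q * pow q n

ιℤ : ℤ → ℚ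
ιℤ z = z / 1

IsInteger : ℚ → Set
IsInteger q = Σ ℤ λ z → q ≡ ιℤ z

_⊛_ : PowerSeries → PowerSeries → PowerSeries
(f ⊛ g) n = sumTo (λ k → f k * g (n ∸ k)) n

psPow : PowerSeries → ℕ → PowerSeries
psPow f zero    zero    = 1ℚ
psPow f zero    (suc n) = 0ℚ
psPow f (suc k)         = f ⊛ psPow f k

-- polynomials in ℚ[x] as coefficient lists (constant term first)
Poly : Set
Poly = List ℚ

polyPS : Poly → PowerSeries
polyPS []       n       = 0ℚ
polyPS (c ∷ cs) zero    = c
polyPS (c ∷ cs) (suc n) = polyPS cs n

NonzeroPoly : Poly → Set
NonzeroPoly p = Any (λ c → c ≢ 0ℚ) p

-- polynomials in ℚ[x][y]: list of ℚ[x]-coefficients of y^0, y^1, ...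
Poly₂ : Set
Poly₂ = List Poly

NonzeroPoly₂ : Poly₂ → Set
NonzeroPoly₂ P = Any NonzeroPoly P

evalAt : Poly₂ → PowerSeries → PowerSeries
evalAt P f = go P 0
  where
  go : Poly₂ → ℕ → PowerSeries
  go []       i n = 0ℚ
  go (p ∷ ps) i n = (polyPS p ⊛ psPow f i) n + go ps (suc i) n

Algebraic : PowerSeries → Set
Algebraic f = Σ Poly₂ λ P → NonzeroPoly₂ P × (∀ n → evalAt P f n ≡ 0ℚ)

AlmostIntegral : PowerSeries → Set
AlmostIntegral f =
  Σ ℤ λ C → C ≢ + 0 × (∀ n → IsInteger (pow (ιℤ C) (suc n) * f (suc n)))

-- nonzero radius of convergence in ℂ (Cauchy–Hadamard):
-- ∃ A, K ∈ ℚ with |a_n| ≤ A·K^n for all n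
PositiveRadius : PowerSeries → Set
PositiveRadius f = Σ ℚ λ A → Σ ℚ λ K → ∀ n → ∣ f n ∣ ≤ A * pow K n

GloballyBounded : PowerSeries → Set
GloballyBounded f = AlmostIntegral f × PositiveRadius f

-- bivariate polynomials in ℚ[x₁,x₂]: entry i of the outer list is the
-- coefficient list (in x₂) of x₁^i
poly₂PS : Poly₂ → PowerSeries₂
poly₂PS []       i       j = 0ℚ
poly₂PS (p ∷ ps) zero    j = polyPS p j
poly₂PS (p ∷ ps) (suc i) j = poly₂PS ps i j

_⊛₂_ : PowerSeries₂ → PowerSeries₂ → PowerSeries₂
(A ⊛₂ B) i j = sumTo (λ a → sumTo (λ b → A a b * B (i ∸ a) (j ∸ b)) j) i

diagonal : PowerSeries₂ → PowerSeries
diagonal R n = R n n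

-- f is the diagonal of a rational function P/Q ∈ ℚ(x₁,x₂) (Q ≠ 0) that
-- admits a power series expansion R ∈ ℚ[[x₁,x₂]], i.e. Q·R = P
DiagonalOfRational₂ : PowerSeries → Set
DiagonalOfRational₂ f =
  Σ Poly₂ λ P → Σ Poly₂ λ Q → Σ PowerSeries₂ λ R →
    NonzeroPoly₂ Q ×
    (∀ i j → (poly₂PS Q ⊛₂ R) i j ≡ poly₂PS P i j) ×
    (∀ n → diagonal R n ≡ f n)

-- the sequence: (n+2) m_n = (2n+1) m_{n-1} + (3n-3) m_{n-2}, n ≥ 2;
-- with n = k+2: m_{k+2} = ((2k+5) m_{k+1} + (3k+3) m_k) / (k+4)
seqM : ℚ → ℚ → ℕ → ℚ
seqM m₀ m₁ zero          = m₀
seqM m₀ m₁ (suc zero)    = m₁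
seqM m₀ m₁ (suc (suc k)) =
  (+ 1 / (4 ℕ.+ k)) *
    ((ιℤ (+ (5 ℕ.+ 2 ℕ.* k)) * seqM m₀ m₁ (suc k))
     + (ιℤ (+ (3 ℕ.+ 3 ℕ.* k)) * seqM m₀ m₁ k))

{-# OPTIONS --safe #-}
module Submission where

-- In terms of θ = x d/dx the recurrence reads D θM + ρ M = 2 m₀ + 3 (m₁ − m₀) x with D = 1 − 2x − 3x² and
-- ρ = 2 − 3x − 3x².
--
-- If m₀ = m₁ = c, the series F = c² + c (x − 1) M + x² M² satisfies D θF = 2 (x − 1) F, which forces F = 0.
-- Moreover mₙ = c ([xⁿ] − [xⁿ⁺²]) (1 + x + x²)ⁿ, because both sides satisfy the recurrence; this gives the
-- integrality, the growth bound and the diagonal of c (1 − y²) / (1 − x (1 + y + y²)).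
--
-- If M is algebraic, let A₀ + … + A_d M^d = 0 be a polynomial relation with A_d ≠ 0. Applying D θ and
-- eliminating M^d yields a relation of degree d − 1, whose top coefficient could vanish only if −A_{d−1} / (d A_d)
-- solved the differential equation. Comparing leading coefficients in x, this is impossible for m₀ ≠ m₁,
-- so the descent ends in a contradiction at degree 0.
--
-- A diagonal of a rational function is almost integral. For an almost integral solution, the Casorati determinant
-- with the Motzkin numbers, n (n+1) (n+2) (mₙ Mₙ₋₁ − mₙ₋₁ Mₙ) = 6 (−3)ⁿ⁻¹ (m₁ − m₀), gives m₀ = m₁: otherwise
-- choose n > 1 coprime to all factors on the right.

open import Defs
open import Data.Rational using (ℚ; _*_)
open import Data.Integer using (ℤ; +_)
open import Data.Product using (Σ; _×_)
open import Function.Bundles using (_⇔_)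
open import Relation.Binary.PropositionalEquality using (_≡_; _≢_)

open import Algebra.Bundles using (AbelianGroup; CommutativeRing)
import Algebra.Properties.Group
import Algebra.Solver.Ring
open import Algebra.Solver.Ring.AlmostCommutativeRing using (fromCommutativeRing; _-Raw-AlmostCommutative⟶_; Induced-equivalence)
open import Algebra.Structures using (IsCommutativeRing)
open import Data.Integer as ℤ using (-[1+_])
import Data.Integer.Properties as ℤₚ
open import Data.Integer.Solver renaming (module +-*-Solver to ℤ-Solver)
open import Data.List using ([]; _∷_; length)
open import Data.List.Relation.Unary.Any using (here; there)
open import Data.Maybe using (map)
open import Data.Nat as ℕ using (ℕ; zero; suc; _∸_; z≤n; s≤s)
open import Data.Nat.Coprimality using (Coprime; coprime-divisor; coprime-+; 1-coprimeTo)
open import Data.Nat.Divisibility using (_∣_; divides; ∣1⇒≡1)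
open import Data.Nat.Induction using (<-rec)
import Data.Nat.Properties as ℕₚ
open import Data.Product using (_,_; proj₁; proj₂; ∃; ∃₂)
open import Data.Rational
  using (0ℚ; 1ℚ; _+_; _-_; -_; _/_; 1/_; ∣_∣; _≤_; _≟_; ≢-nonZero; nonNegative; ↥_; ↧_; ↧ₙ_; toℚᵘ)
import Data.Rational.Properties as ℚₚ
import Data.Rational.Unnormalised as ℚᵘ
import Data.Rational.Unnormalised.Properties as ℚᵘₚ
open import Data.Sum using (_⊎_; inj₁; inj₂)
open import Function.Bundles using (mk⇔)
open import Level using (0ℓ)
open import Relation.Binary.Definitions using (WeaklyDecidable; tri<; tri≈; tri>)
open import Relation.Binary.PropositionalEquality
  using (refl; sym; trans; cong; cong₂; subst; module ≡-Reasoning)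
import Relation.Binary.Reasoning.Setoid
open import Relation.Nullary using (¬_; yes; no; contradiction)
open import Relation.Nullary.Decidable using (decidable-stable)
open import Relation.Nullary.Decidable.Core using (dec⇒maybe)

-- The homogeneous equation D θy + ρ y = 0 is solved by √D / x², because ρ - 2D = -(θD) / 2. For m₀
-- = m₁ = c the series is therefore c (1 - x - √D) / (2x²), and F is its quadratic relation.
-- Verifying F through its own differential equation avoids forming the square root.
--
-- For m₀ ≠ m₁ the descent replaces a trace: the equation is affine, so the mean of the conjugates
-- of an algebraic solution would be a rational solution, and -A_{d-1} / (d A_d) is that mean. The
-- obstruction is a resonance at infinity: D θ + ρ sends x^e to -3 (e + 1) x^(e+2) plus lower terms,
-- so the exponent e = -1, the one that could produce the linear term of the right-hand side, is
-- annihilated to leading order.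
--
-- Dividing by n + 2 in the recurrence says little about integrality by itself. Comparison with an
-- integral solution does: the Casorati determinant has an explicit denominator n (n+1) (n+2), while
-- only finitely many primes divide its numerators.

module ℤ-Group = Algebra.Properties.Group (AbelianGroup.group ℤₚ.+-0-abelianGroup)
module ℚ-Group = Algebra.Properties.Group ℚₚ.+-0-group

-- Rational numbers and integrality

ιᵘ : ℤ → ℚᵘ.ℚᵘ
ιᵘ z = ℚᵘ.mkℚᵘ z 0

toℚᵘ-ιℤ : ∀ z → toℚᵘ (ιℤ z) ℚᵘ.≃ ιᵘ z
toℚᵘ-ιℤ z = ℚₚ.toℚᵘ-fromℚᵘ (ιᵘ z)

ιℤ-homo-+ : ∀ a b → ιℤ (a ℤ.+ b) ≡ ιℤ a + ιℤ b
ιℤ-homo-+ a b = ℚₚ.toℚᵘ-injective (begin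
  toℚᵘ (ιℤ (a ℤ.+ b))               ≈⟨ toℚᵘ-ιℤ (a ℤ.+ b) ⟩
  ιᵘ (a ℤ.+ b)                      ≡⟨ cong₂ (λ x y → ιᵘ (x ℤ.+ y)) (ℤₚ.*-identityʳ a) (ℤₚ.*-identityʳ b) ⟨
  ιᵘ a ℚᵘ.+ ιᵘ b                    ≈⟨ ℚᵘₚ.+-cong (toℚᵘ-ιℤ a) (toℚᵘ-ιℤ b) ⟨
  toℚᵘ (ιℤ a) ℚᵘ.+ toℚᵘ (ιℤ b)      ≈⟨ ℚₚ.toℚᵘ-homo-+ (ιℤ a) (ιℤ b) ⟨
  toℚᵘ (ιℤ a + ιℤ b)                ∎)
  where open ℚᵘₚ.≃-Reasoning

ιℤ-homo-* : ∀ a b → ιℤ (a ℤ.* b) ≡ ιℤ a * ιℤ b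
ιℤ-homo-* a b = ℚₚ.toℚᵘ-injective (begin
  toℚᵘ (ιℤ (a ℤ.* b))               ≈⟨ toℚᵘ-ιℤ (a ℤ.* b) ⟩
  ιᵘ a ℚᵘ.* ιᵘ b                    ≈⟨ ℚᵘₚ.*-cong (toℚᵘ-ιℤ a) (toℚᵘ-ιℤ b) ⟨
  toℚᵘ (ιℤ a) ℚᵘ.* toℚᵘ (ιℤ b)      ≈⟨ ℚₚ.toℚᵘ-homo-* (ιℤ a) (ιℤ b) ⟨
  toℚᵘ (ιℤ a * ιℤ b)                ∎)
  where open ℚᵘₚ.≃-Reasoning

ιℤ-homo‿- : ∀ a → ιℤ (ℤ.- a) ≡ - ιℤ a
ιℤ-homo‿- a = ℚₚ.toℚᵘ-injective (begin
  toℚᵘ (ιℤ (ℤ.- a))                 ≈⟨ toℚᵘ-ιℤ (ℤ.- a) ⟩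
  ℚᵘ.- ιᵘ a                         ≈⟨ ℚᵘₚ.-‿cong (toℚᵘ-ιℤ a) ⟨
  ℚᵘ.- toℚᵘ (ιℤ a)                  ≈⟨ ℚₚ.toℚᵘ-homo‿- (ιℤ a) ⟨
  toℚᵘ (- ιℤ a)                     ∎)
  where open ℚᵘₚ.≃-Reasoning

ιℤ-injective : ∀ {a b} → ιℤ a ≡ ιℤ b → a ≡ b
ιℤ-injective {a} {b} eq = begin
  a             ≡⟨ ℤₚ.*-identityʳ a ⟨
  a ℤ.* + 1     ≡⟨ ℚᵘₚ.drop-*≡* (ℚᵘₚ.≃-trans (ℚᵘₚ.≃-sym (toℚᵘ-ιℤ a)) (ℚᵘₚ.≃-trans (ℚᵘₚ.≃-reflexive (cong toℚᵘ eq)) (toℚᵘ-ιℤ b))) ⟩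
  b ℤ.* + 1     ≡⟨ ℤₚ.*-identityʳ b ⟩
  b             ∎
  where open ≡-Reasoning

ιℕ : ℕ → ℚ
ιℕ n = ιℤ (+ n)

ιℕ-suc : ∀ n → ιℕ (suc n) ≡ 1ℚ + ιℕ n
ιℕ-suc n = ιℤ-homo-+ (+ 1) (+ n)

ιℕ-injective : ∀ {m n} → ιℕ m ≡ ιℕ n → m ≡ n
ιℕ-injective eq = ℤₚ.+-injective (ιℤ-injective eq)

ιℕ-suc≢0 : ∀ n → ιℕ (suc n) ≢ 0ℚ
ιℕ-suc≢0 n eq with () ← ιℕ-injective {suc n} {0} eq

unit-fraction : ∀ n .{{_ : ℕ.NonZero n}} → (+ 1 / n) * ιℕ n ≡ 1ℚ
unit-fraction n@(suc m) = ℚₚ.toℚᵘ-injective (begin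
  toℚᵘ ((+ 1 / n) * ιℕ n)                 ≈⟨ ℚₚ.toℚᵘ-homo-* (+ 1 / n) (ιℕ n) ⟩
  toℚᵘ (+ 1 / n) ℚᵘ.* toℚᵘ (ιℕ n)         ≈⟨ ℚᵘₚ.*-cong (ℚₚ.toℚᵘ-fromℚᵘ (ℚᵘ.mkℚᵘ (+ 1) m)) (toℚᵘ-ιℤ (+ n)) ⟩
  ℚᵘ.mkℚᵘ (+ 1) m ℚᵘ.* ιᵘ (+ n)           ≈⟨ ℚᵘ.*≡* (trans (ℤₚ.*-identityʳ _) (cong (+ 1 ℤ.*_) (cong +_ (sym (ℕₚ.*-identityʳ n))))) ⟩
  ℚᵘ.1ℚᵘ                                  ∎)
  where open ℚᵘₚ.≃-Reasoning

clear-denominator : ∀ q → ιℕ (↧ₙ q) * q ≡ ιℤ (↥ q)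
clear-denominator q = ℚₚ.toℚᵘ-injective (begin
  toℚᵘ (ιℕ (↧ₙ q) * q)              ≈⟨ ℚₚ.toℚᵘ-homo-* (ιℕ (↧ₙ q)) q ⟩
  toℚᵘ (ιℕ (↧ₙ q)) ℚᵘ.* toℚᵘ q      ≈⟨ ℚᵘₚ.*-congʳ {toℚᵘ q} (toℚᵘ-ιℤ (↧ q)) ⟩
  ιᵘ (↧ q) ℚᵘ.* toℚᵘ q              ≈⟨ lemma q ⟩
  ιᵘ (↥ q)                          ≈⟨ toℚᵘ-ιℤ (↥ q) ⟨
  toℚᵘ (ιℤ (↥ q))                   ∎)
  where
  open ℚᵘₚ.≃-Reasoning
  lemma : ∀ q → ιᵘ (↧ q) ℚᵘ.* toℚᵘ q ℚᵘ.≃ ιᵘ (↥ q)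
  lemma q@record{} = ℚᵘ.*≡* (trans (ℤₚ.*-identityʳ _) (trans (ℤₚ.*-comm (↧ q) (↥ q)) (cong (λ d → ↥ q ℤ.* + d) (sym (ℕₚ.*-identityˡ (↧ₙ q))))))

*-cancelˡ-≢0 : ∀ {p q r} → p ≢ 0ℚ → p * q ≡ p * r → q ≡ r
*-cancelˡ-≢0 {p} {q} {r} p≢0 eq = begin
  q                 ≡⟨ ℚₚ.*-identityˡ q ⟨
  1ℚ * q            ≡⟨ cong (_* q) (ℚₚ.*-inverseˡ p) ⟨
  (1/ p) * p * q    ≡⟨ ℚₚ.*-assoc (1/ p) p q ⟩
  (1/ p) * (p * q)  ≡⟨ cong ((1/ p) *_) eq ⟩
  (1/ p) * (p * r)  ≡⟨ ℚₚ.*-assoc (1/ p) p r ⟨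
  (1/ p) * p * r    ≡⟨ cong (_* r) (ℚₚ.*-inverseˡ p) ⟩
  1ℚ * r            ≡⟨ ℚₚ.*-identityˡ r ⟩
  r                 ∎
  where
  open ≡-Reasoning
  instance p-nonZero = ≢-nonZero p≢0

*-≢0 : ∀ {p q} → p ≢ 0ℚ → q ≢ 0ℚ → p * q ≢ 0ℚ
*-≢0 {p} p≢0 q≢0 pq≡0 = q≢0 (*-cancelˡ-≢0 p≢0 (trans pq≡0 (sym (ℚₚ.*-zeroʳ p))))

ιℤ-≢0 : ∀ {z} → z ≢ + 0 → ιℤ z ≢ 0ℚ
ιℤ-≢0 z≢0 eq = z≢0 (ιℤ-injective {b = + 0} eq)

-- Integer coefficients let the ring solver evaluate numerals by integer arithmetic; rational
-- parameters enter it as variables.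
ιℤ-morphism : CommutativeRing.rawRing ℤₚ.+-*-commutativeRing -Raw-AlmostCommutative⟶ fromCommutativeRing ℚₚ.+-*-commutativeRing
ιℤ-morphism = record
  { ⟦_⟧ = ιℤ ; +-homo = ιℤ-homo-+ ; *-homo = ιℤ-homo-* ; -‿homo = ιℤ-homo‿-
  ; 0-homo = refl ; 1-homo = refl }

ιℤ-≟ : WeaklyDecidable (Induced-equivalence ιℤ-morphism)
ιℤ-≟ a b = map (cong ιℤ) (dec⇒maybe (a ℤ.≟ b))

module ℚ-Solver = Algebra.Solver.Ring
  (CommutativeRing.rawRing ℤₚ.+-*-commutativeRing)
  (fromCommutativeRing ℚₚ.+-*-commutativeRing)
  ιℤ-morphism ιℤ-≟

pow-+ : ∀ q m n → pow q (m ℕ.+ n) ≡ pow q m * pow q n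
pow-+ q zero    n = sym (ℚₚ.*-identityˡ _)
pow-+ q (suc m) n = trans (cong (q *_) (pow-+ q m n)) (sym (ℚₚ.*-assoc q _ _))

pow-* : ∀ q m n → pow q (m ℕ.* n) ≡ pow (pow q m) n
pow-* q m zero    = cong (pow q) (ℕₚ.*-zeroʳ m)
pow-* q m (suc n) = begin
  pow q (m ℕ.* suc n)       ≡⟨ cong (pow q) (ℕₚ.*-suc m n) ⟩
  pow q (m ℕ.+ m ℕ.* n)     ≡⟨ pow-+ q m (m ℕ.* n) ⟩
  pow q m * pow q (m ℕ.* n) ≡⟨ cong (pow q m *_) (pow-* q m n) ⟩
  pow q m * pow (pow q m) n ∎
  where open ≡-Reasoning

pow-ιℤ : ∀ z n → pow (ιℤ z) n ≡ ιℤ (z ℤ.^ n)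
pow-ιℤ z zero    = refl
pow-ιℤ z (suc n) = trans (cong (ιℤ z *_) (pow-ιℤ z n)) (sym (ιℤ-homo-* z (z ℤ.^ n)))

ιℤ-integer : ∀ z → IsInteger (ιℤ z)
ιℤ-integer z = z , refl

pow-integer : ∀ z n → IsInteger (pow (ιℤ z) n)
pow-integer z n = z ℤ.^ n , pow-ιℤ z n

+-integer : ∀ {p q} → IsInteger p → IsInteger q → IsInteger (p + q)
+-integer (a , refl) (b , refl) = a ℤ.+ b , sym (ιℤ-homo-+ a b)

*-integer : ∀ {p q} → IsInteger p → IsInteger q → IsInteger (p * q)
*-integer (a , refl) (b , refl) = a ℤ.* b , sym (ιℤ-homo-* a b)

neg-integer : ∀ {p} → IsInteger p → IsInteger (- p)
neg-integer (a , refl) = ℤ.- a , sym (ιℤ-homo‿- a)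

-- The ring of power series

sumTo-cong : ∀ {f g} n → (∀ k → k ℕ.≤ n → f k ≡ g k) → sumTo f n ≡ sumTo g n
sumTo-cong zero    f≡g = f≡g 0 z≤n
sumTo-cong (suc n) f≡g = cong₂ _+_ (sumTo-cong n λ k k≤n → f≡g k (ℕₚ.m≤n⇒m≤1+n k≤n)) (f≡g (suc n) ℕₚ.≤-refl)

sumTo-+ : ∀ f g n → sumTo (λ k → f k + g k) n ≡ sumTo f n + sumTo g n
sumTo-+ f g zero    = refl
sumTo-+ f g (suc n) = trans (cong (_+ (f (suc n) + g (suc n))) (sumTo-+ f g n))
  (solve 4 (λ a b c d → (a :+ b) :+ (c :+ d) := (a :+ c) :+ (b :+ d)) refl (sumTo f n) (sumTo g n) (f (suc n)) (g (suc n)))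
  where open ℚ-Solver

sumTo-*ˡ : ∀ c f n → sumTo (λ k → c * f k) n ≡ c * sumTo f n
sumTo-*ˡ c f zero    = refl
sumTo-*ˡ c f (suc n) = trans (cong (_+ c * f (suc n)) (sumTo-*ˡ c f n)) (sym (ℚₚ.*-distribˡ-+ c _ _))

sumTo-zero : ∀ {f} n → (∀ k → k ℕ.≤ n → f k ≡ 0ℚ) → sumTo f n ≡ 0ℚ
sumTo-zero zero    f≡0 = f≡0 0 z≤n
sumTo-zero (suc n) f≡0 = cong₂ _+_ (sumTo-zero n λ k k≤n → f≡0 k (ℕₚ.m≤n⇒m≤1+n k≤n)) (f≡0 (suc n) ℕₚ.≤-refl)

sumTo-suc : ∀ f n → sumTo f (suc n) ≡ f 0 + sumTo (λ k → f (suc k)) n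
sumTo-suc f zero    = refl
sumTo-suc f (suc n) = trans (cong (_+ f (suc (suc n))) (sumTo-suc f n)) (ℚₚ.+-assoc (f 0) _ _)

tail : PowerSeries → PowerSeries
tail f n = f (suc n)

infix  4 _≈_
infixl 6 _⊕_
infixl 7 _·_
infix  8 ⊝_

-- A record rather than the bare pointwise equality, so that the two series can be recovered from
-- the type by unification.
record _≈_ (f g : PowerSeries) : Set where
  constructor coeffs
  field coeff : ∀ n → f n ≡ g n
open _≈_ public

κ : ℚ → PowerSeries
κ q zero    = q
κ q (suc n) = 0ℚ

κ-zero : ∀ n → κ 0ℚ n ≡ 0ℚ
κ-zero zero    = refl
κ-zero (suc n) = refl

_⊕_ : PowerSeries → PowerSeries → PowerSeries
(f ⊕ g) n = f n + g n

⊝_ : PowerSeries → PowerSeries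
(⊝ f) n = - f n

⊛-cong : ∀ {f f′ g g′} → f ≈ f′ → g ≈ g′ → f ⊛ g ≈ f′ ⊛ g′
⊛-cong f≈ g≈ = coeffs λ n → sumTo-cong n λ k _ → cong₂ _*_ (coeff f≈ k) (coeff g≈ (n ∸ k))

⊛-suc : ∀ f g n → (f ⊛ g) (suc n) ≡ f 0 * g (suc n) + (tail f ⊛ g) n
⊛-suc f g n = sumTo-suc _ n

⊛-suc′ : ∀ f g n → (f ⊛ g) (suc n) ≡ (f ⊛ tail g) n + f (suc n) * g 0
⊛-suc′ f g n = cong₂ _+_
  (sumTo-cong n λ k k≤n → cong (λ j → f k * g j) (ℕₚ.+-∸-assoc 1 k≤n))
  (cong (λ j → f (suc n) * g j) (ℕₚ.n∸n≡0 n))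

-- `⊛-suc` removes the head of the left factor and `⊛-suc′` that of the right one, so an induction
-- on the coefficient index that is uniform in both series goes through.
⊛-comm-coeff : ∀ n f g → (f ⊛ g) n ≡ (g ⊛ f) n
⊛-comm-coeff zero    f g = ℚₚ.*-comm (f 0) (g 0)
⊛-comm-coeff (suc n) f g = begin
  (f ⊛ g) (suc n)                      ≡⟨ ⊛-suc f g n ⟩
  f 0 * g (suc n) + (tail f ⊛ g) n     ≡⟨ ℚₚ.+-comm (f 0 * g (suc n)) _ ⟩
  (tail f ⊛ g) n + f 0 * g (suc n)     ≡⟨ cong₂ _+_ (⊛-comm-coeff n (tail f) g) (ℚₚ.*-comm (f 0) (g (suc n))) ⟩
  (g ⊛ tail f) n + g (suc n) * f 0     ≡⟨ ⊛-suc′ g f n ⟨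
  (g ⊛ f) (suc n)                      ∎
  where open ≡-Reasoning

⊛-distribʳ : ∀ h f g → (f ⊕ g) ⊛ h ≈ (f ⊛ h) ⊕ (g ⊛ h)
⊛-distribʳ h f g = coeffs λ n → trans
  (sumTo-cong n λ k _ → ℚₚ.*-distribʳ-+ (h (n ∸ k)) (f k) (g k))
  (sumTo-+ _ _ n)

κ-⊛ : ∀ c f n → (κ c ⊛ f) n ≡ c * f n
κ-⊛ c f zero    = refl
κ-⊛ c f (suc n) = begin
  (κ c ⊛ f) (suc n)                     ≡⟨ ⊛-suc (κ c) f n ⟩
  c * f (suc n) + (tail (κ c) ⊛ f) n    ≡⟨ cong (_+_ (c * f (suc n))) (sumTo-zero n λ k _ → ℚₚ.*-zeroˡ (f (n ∸ k))) ⟩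
  c * f (suc n) + 0ℚ                    ≡⟨ ℚₚ.+-identityʳ _ ⟩
  c * f (suc n)                         ∎
  where open ≡-Reasoning

⊛-scaleˡ : ∀ c f g n → ((λ k → c * f k) ⊛ g) n ≡ c * (f ⊛ g) n
⊛-scaleˡ c f g n = trans
  (sumTo-cong n λ k _ → ℚₚ.*-assoc c (f k) (g (n ∸ k)))
  (sumTo-*ˡ c _ n)

⊛-assoc-coeff : ∀ n f g h → ((f ⊛ g) ⊛ h) n ≡ (f ⊛ (g ⊛ h)) n
⊛-assoc-coeff zero    f g h = ℚₚ.*-assoc (f 0) (g 0) (h 0)
⊛-assoc-coeff (suc n) f g h = begin
  ((f ⊛ g) ⊛ h) (suc n)
    ≡⟨ ⊛-suc (f ⊛ g) h n ⟩
  f 0 * g 0 * h (suc n) + (tail (f ⊛ g) ⊛ h) n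
    ≡⟨ cong (_+_ (f 0 * g 0 * h (suc n))) (coeff (⊛-cong {g = h} (coeffs (⊛-suc f g)) (coeffs λ _ → refl)) n) ⟩
  f 0 * g 0 * h (suc n) + (((λ k → f 0 * g (suc k)) ⊕ (tail f ⊛ g)) ⊛ h) n
    ≡⟨ cong (_+_ (f 0 * g 0 * h (suc n))) (coeff (⊛-distribʳ h (λ k → f 0 * g (suc k)) (tail f ⊛ g)) n) ⟩
  f 0 * g 0 * h (suc n) + (((λ k → f 0 * g (suc k)) ⊛ h) n + ((tail f ⊛ g) ⊛ h) n)
    ≡⟨ cong₂ (λ a b → f 0 * g 0 * h (suc n) + (a + b)) (⊛-scaleˡ (f 0) (tail g) h n) (⊛-assoc-coeff n (tail f) g h) ⟩
  f 0 * g 0 * h (suc n) + (f 0 * (tail g ⊛ h) n + (tail f ⊛ (g ⊛ h)) n)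
    ≡⟨ solve 5 (λ a b c d e → (a :* b) :* c :+ (a :* d :+ e) := a :* (b :* c :+ d) :+ e) refl (f 0) (g 0) (h (suc n)) _ _ ⟩
  f 0 * (g 0 * h (suc n) + (tail g ⊛ h) n) + (tail f ⊛ (g ⊛ h)) n
    ≡⟨ cong (λ a → f 0 * a + (tail f ⊛ (g ⊛ h)) n) (⊛-suc g h n) ⟨
  f 0 * (g ⊛ h) (suc n) + (tail f ⊛ (g ⊛ h)) n
    ≡⟨ ⊛-suc f (g ⊛ h) n ⟨
  (f ⊛ (g ⊛ h)) (suc n) ∎
  where
  open ≡-Reasoning
  open ℚ-Solver

⊛-comm : ∀ f g → f ⊛ g ≈ g ⊛ f
⊛-comm f g = coeffs λ n → ⊛-comm-coeff n f g

-- The Euler derivation and the ring of power series.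

θ : PowerSeries → PowerSeries
θ f n = ιℕ n * f n

θ-cong : ∀ {f g} → f ≈ g → θ f ≈ θ g
θ-cong e = coeffs λ n → cong (ιℕ n *_) (coeff e n)

θ-⊕ : ∀ f g → θ (f ⊕ g) ≈ θ f ⊕ θ g
θ-⊕ f g = coeffs λ n → ℚₚ.*-distribˡ-+ (ιℕ n) (f n) (g n)

-- Leibniz rule: the weight n of the term f k * g (n ∸ k) splits as k + (n ∸ k).
θ-⊛ : ∀ f g → θ (f ⊛ g) ≈ (θ f ⊛ g) ⊕ (f ⊛ θ g)
θ-⊛ f g = coeffs λ n → begin
  ιℕ n * (f ⊛ g) n
    ≡⟨ sumTo-*ˡ (ιℕ n) _ n ⟨
  sumTo (λ k → ιℕ n * (f k * g (n ∸ k))) n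
    ≡⟨ sumTo-cong n (λ k k≤n → trans
         (cong (_* (f k * g (n ∸ k))) (trans (cong ιℕ (sym (ℕₚ.m+[n∸m]≡n k≤n))) (ιℤ-homo-+ (+ k) (+ (n ∸ k)))))
         (solve 4 (λ a b c d → (a :+ b) :* (c :* d) := (a :* c) :* d :+ c :* (b :* d)) refl (ιℕ k) (ιℕ (n ∸ k)) (f k) (g (n ∸ k)))) ⟩
  sumTo (λ k → θ f k * g (n ∸ k) + f k * θ g (n ∸ k)) n
    ≡⟨ sumTo-+ _ _ n ⟩
  (θ f ⊛ g) n + (f ⊛ θ g) n ∎
  where
  open ≡-Reasoning
  open ℚ-Solver

-- Sealing the product keeps the unifier from unfolding products into finite sums.
opaque
  _·_ : PowerSeries → PowerSeries → PowerSeries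
  _·_ = _⊛_

opaque
  unfolding _·_

  ⊛≈· : ∀ f g → f ⊛ g ≈ f · g
  ⊛≈· f g = coeffs λ _ → refl

  ·-zero : ∀ f g → (f · g) 0 ≡ f 0 * g 0
  ·-zero f g = refl

  ·-suc : ∀ f g n → (f · g) (suc n) ≡ f 0 * g (suc n) + (tail f · g) n
  ·-suc = ⊛-suc

  ·-low : ∀ f {g} n → (∀ k → k ℕ.≤ n → g k ≡ 0ℚ) → (f · g) n ≡ 0ℚ
  ·-low f n g≡0 = sumTo-zero n λ k _ → trans (cong (_*_ (f k)) (g≡0 (n ∸ k) (ℕₚ.m∸n≤m n k))) (ℚₚ.*-zeroʳ (f k))

  κ-· : ∀ c f n → (κ c · f) n ≡ c * f n
  κ-· = κ-⊛

  θ-· : ∀ f g → θ (f · g) ≈ θ f · g ⊕ f · θ g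
  θ-· = θ-⊛

  ·-isCommutativeRing : IsCommutativeRing _≈_ _⊕_ _·_ ⊝_ (κ 0ℚ) (κ 1ℚ)
  ·-isCommutativeRing = record
    { isRing = record
            { +-isAbelianGroup = record
              { isGroup = record
                { isMonoid = record
                  { isSemigroup = record
                    { isMagma = record
                      { isEquivalence = record
                        { refl  = coeffs λ _ → refl
                        ; sym   = λ e → coeffs λ n → sym (coeff e n)
                        ; trans = λ e e′ → coeffs λ n → trans (coeff e n) (coeff e′ n)
                        }
                      ; ∙-cong = λ e e′ → coeffs λ n → cong₂ _+_ (coeff e n) (coeff e′ n)
                      }
                    ; assoc = λ f g h → coeffs λ n → ℚₚ.+-assoc (f n) (g n) (h n)
                    }
                  ; identity = (λ f → coeffs λ { zero → ℚₚ.+-identityˡ (f 0) ; (suc n) → ℚₚ.+-identityˡ (f (suc n)) })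
                             , (λ f → coeffs λ { zero → ℚₚ.+-identityʳ (f 0) ; (suc n) → ℚₚ.+-identityʳ (f (suc n)) })
                  }
                ; inverse = (λ f → coeffs λ { zero → ℚₚ.+-inverseˡ (f 0) ; (suc n) → ℚₚ.+-inverseˡ (f (suc n)) })
                          , (λ f → coeffs λ { zero → ℚₚ.+-inverseʳ (f 0) ; (suc n) → ℚₚ.+-inverseʳ (f (suc n)) })
                ; ⁻¹-cong = λ e → coeffs λ n → cong -_ (coeff e n)
                }
              ; comm = λ f g → coeffs λ n → ℚₚ.+-comm (f n) (g n)
              }
            ; *-cong = ⊛-cong
            ; *-assoc = λ f g h → coeffs λ n → ⊛-assoc-coeff n f g h
            ; *-identity = identityˡ , λ f → coeffs λ n → trans (⊛-comm-coeff n f (κ 1ℚ)) (coeff (identityˡ f) n)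
            ; distrib = (λ h f g → coeffs λ n → trans (⊛-comm-coeff n h (f ⊕ g)) (trans (coeff (⊛-distribʳ h f g) n)
                          (cong₂ _+_ (⊛-comm-coeff n f h) (⊛-comm-coeff n g h))))
                      , ⊛-distribʳ
            }
          ; *-comm = ⊛-comm
          }
    where
    identityˡ : ∀ f → κ 1ℚ ⊛ f ≈ f
    identityˡ f = coeffs λ n → trans (κ-⊛ 1ℚ f n) (ℚₚ.*-identityˡ (f n))

PS : CommutativeRing 0ℓ 0ℓ
PS = record { isCommutativeRing = ·-isCommutativeRing }

κ-homo-+ : ∀ a b → κ (a + b) ≈ κ a ⊕ κ b
κ-homo-+ a b = coeffs λ { zero → refl ; (suc n) → refl }

κ-homo-* : ∀ a b → κ (a * b) ≈ κ a · κ b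
κ-homo-* a b = coeffs λ { zero → sym (·-zero (κ a) (κ b)) ; (suc n) → sym (trans (κ-· a (κ b) (suc n)) (ℚₚ.*-zeroʳ a)) }

κ-homo‿- : ∀ a → κ (- a) ≈ ⊝ κ a
κ-homo‿- a = coeffs λ { zero → refl ; (suc n) → refl }

module PS = CommutativeRing PS

κιℤ-morphism : CommutativeRing.rawRing ℤₚ.+-*-commutativeRing -Raw-AlmostCommutative⟶ fromCommutativeRing PS
κιℤ-morphism = record
  { ⟦_⟧ = λ z → κ (ιℤ z)
  ; +-homo = λ a b → PS.trans (PS.reflexive (cong κ (ιℤ-homo-+ a b))) (κ-homo-+ (ιℤ a) (ιℤ b))
  ; *-homo = λ a b → PS.trans (PS.reflexive (cong κ (ιℤ-homo-* a b))) (κ-homo-* (ιℤ a) (ιℤ b))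
  ; -‿homo = λ a → PS.trans (PS.reflexive (cong κ (ιℤ-homo‿- a))) (κ-homo‿- (ιℤ a))
  ; 0-homo = PS.refl ; 1-homo = PS.refl }

κιℤ-≟ : WeaklyDecidable (Induced-equivalence κιℤ-morphism)
κιℤ-≟ a b = map (λ a≡b → PS.reflexive (cong (λ z → κ (ιℤ z)) a≡b)) (dec⇒maybe (a ℤ.≟ b))

module PS-Solver = Algebra.Solver.Ring
  (CommutativeRing.rawRing ℤₚ.+-*-commutativeRing)
  (fromCommutativeRing PS)
  κιℤ-morphism κιℤ-≟

θ-κ : ∀ c → θ (κ c) ≈ κ 0ℚ
θ-κ c = coeffs λ { zero → ℚₚ.*-zeroˡ c ; (suc n) → ℚₚ.*-zeroʳ (ιℕ (suc n)) }

-- Polynomials as power series.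

X : PowerSeries
X = polyPS (0ℚ ∷ 1ℚ ∷ [])

-- Horner form in the operations of `PS`: rewriting with `polyPS≈` makes the coefficients of a
-- concrete polynomial visible to the ring solver.
⟦_⟧ₚ : Poly → PowerSeries
⟦ []     ⟧ₚ = κ 0ℚ
⟦ c ∷ cs ⟧ₚ = κ c ⊕ X · ⟦ cs ⟧ₚ

[]-· : ∀ f n → (polyPS [] · f) n ≡ 0ℚ
[]-· f zero    = trans (·-zero (polyPS []) f) (ℚₚ.*-zeroˡ (f 0))
[]-· f (suc n) = trans (·-suc (polyPS []) f n) (trans (cong₂ _+_ (ℚₚ.*-zeroˡ (f (suc n))) ([]-· f n)) refl)

[c]-· : ∀ c f n → (polyPS (c ∷ []) · f) n ≡ c * f n
[c]-· c f zero    = ·-zero (polyPS (c ∷ [])) f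
[c]-· c f (suc n) = trans (·-suc (polyPS (c ∷ [])) f n) (trans (cong (_+_ (c * f (suc n))) ([]-· f n)) (ℚₚ.+-identityʳ _))

X-·-suc : ∀ f n → (X · f) (suc n) ≡ f n
X-·-suc f n = trans (·-suc X f n)
  (trans (cong₂ _+_ (ℚₚ.*-zeroˡ (f (suc n))) ([c]-· 1ℚ f n)) (trans (ℚₚ.+-identityˡ _) (ℚₚ.*-identityˡ (f n))))

polyPS≈ : ∀ p → polyPS p ≈ ⟦ p ⟧ₚ
polyPS≈ []       = coeffs λ { zero → refl ; (suc n) → refl }
polyPS≈ (c ∷ cs) = coeffs λ
  { zero    → sym (trans (cong (_+_ c) (trans (·-zero X ⟦ cs ⟧ₚ) (ℚₚ.*-zeroˡ (⟦ cs ⟧ₚ 0)))) (ℚₚ.+-identityʳ c))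
  ; (suc n) → trans (coeff (polyPS≈ cs) n) (sym (trans (ℚₚ.+-identityˡ _) (X-·-suc ⟦ cs ⟧ₚ n)))
  }

θ-X : θ X ≈ X
θ-X = coeffs λ { zero → refl ; (suc zero) → refl ; (suc (suc n)) → ℚₚ.*-zeroʳ (ιℕ (suc (suc n))) }

-- The recurrence as a differential equation

ιℕ-homo-+ : ∀ a b → ιℕ (a ℕ.+ b) ≡ ιℕ a + ιℕ b
ιℕ-homo-+ a b = ιℤ-homo-+ (+ a) (+ b)

ιℕ-homo-* : ∀ a b → ιℕ (a ℕ.* b) ≡ ιℕ a * ιℕ b
ιℕ-homo-* a b = trans (cong ιℤ (ℤₚ.pos-* a b)) (ιℤ-homo-* (+ a) (+ b))

-- Denominators are cleared and the index appears only as the atom `ιℕ k`, a form on which the ring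
-- solver can work.
Recurrence : PowerSeries → Set
Recurrence m = ∀ k → (ιℕ 4 + ιℕ k) * m (2 ℕ.+ k) ≡ (ιℕ 5 + ιℕ 2 * ιℕ k) * m (1 ℕ.+ k) + (ιℕ 3 + ιℕ 3 * ιℕ k) * m k

seqM-recurrence : ∀ m₀ m₁ → Recurrence (seqM m₀ m₁)
seqM-recurrence m₀ m₁ k = begin
  (ιℕ 4 + ιℕ k) * seqM m₀ m₁ (2 ℕ.+ k)           ≡⟨ cong (_* seqM m₀ m₁ (2 ℕ.+ k)) (ιℕ-homo-+ 4 k) ⟨
  ιℕ (4 ℕ.+ k) * ((+ 1 / (4 ℕ.+ k)) * rhs)       ≡⟨ ℚₚ.*-assoc (ιℕ (4 ℕ.+ k)) _ rhs ⟨
  ιℕ (4 ℕ.+ k) * (+ 1 / (4 ℕ.+ k)) * rhs         ≡⟨ cong (_* rhs) (trans (ℚₚ.*-comm (ιℕ (4 ℕ.+ k)) _) (unit-fraction (4 ℕ.+ k))) ⟩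
  1ℚ * rhs                                       ≡⟨ ℚₚ.*-identityˡ rhs ⟩
  rhs                                            ≡⟨ cong₂ (λ x y → x * seqM m₀ m₁ (1 ℕ.+ k) + y * seqM m₀ m₁ k) (lin 5 2) (lin 3 3) ⟩
  (ιℕ 5 + ιℕ 2 * ιℕ k) * seqM m₀ m₁ (1 ℕ.+ k) + (ιℕ 3 + ιℕ 3 * ιℕ k) * seqM m₀ m₁ k  ∎
  where
  open ≡-Reasoning
  rhs = (ιℕ (5 ℕ.+ 2 ℕ.* k) * seqM m₀ m₁ (suc k)) + (ιℕ (3 ℕ.+ 3 ℕ.* k) * seqM m₀ m₁ k)
  lin : ∀ a b → ιℕ (a ℕ.+ b ℕ.* k) ≡ ιℕ a + ιℕ b * ιℕ k
  lin a b = trans (ιℕ-homo-+ a (b ℕ.* k)) (cong (_+_ (ιℕ a)) (ιℕ-homo-* b k))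

recurrence-unique : ∀ {f g} → Recurrence f → Recurrence g → f 0 ≡ g 0 → f 1 ≡ g 1 → ∀ n → f n ≡ g n
recurrence-unique {f} {g} rf rg e₀ e₁ n = proj₁ (both n)
  where
  both : ∀ n → f n ≡ g n × f (suc n) ≡ g (suc n)
  both zero    = e₀ , e₁
  both (suc n) with both n
  ... | e , e′ = e′ , *-cancelˡ-≢0 4+n≢0 (begin
    (ιℕ 4 + ιℕ n) * f (2 ℕ.+ n)  ≡⟨ rf n ⟩
    (ιℕ 5 + ιℕ 2 * ιℕ n) * f (1 ℕ.+ n) + (ιℕ 3 + ιℕ 3 * ιℕ n) * f n  ≡⟨ cong₂ (λ x y → (ιℕ 5 + ιℕ 2 * ιℕ n) * x + (ιℕ 3 + ιℕ 3 * ιℕ n) * y) e′ e ⟩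
    (ιℕ 5 + ιℕ 2 * ιℕ n) * g (1 ℕ.+ n) + (ιℕ 3 + ιℕ 3 * ιℕ n) * g n  ≡⟨ rg n ⟨
    (ιℕ 4 + ιℕ n) * g (2 ℕ.+ n)  ∎)
    where
    open ≡-Reasoning
    4+n≢0 : ιℕ 4 + ιℕ n ≢ 0ℚ
    4+n≢0 eq = ιℕ-suc≢0 (3 ℕ.+ n) (trans (ιℕ-homo-+ 4 n) eq)

linear-· : ∀ a b p f → (polyPS (a ∷ b ∷ p) · f) 1 ≡ a * f 1 + b * f 0
linear-· a b p f = trans (·-suc (polyPS (a ∷ b ∷ p)) f 0) (cong (_+_ (a * f 1)) (·-zero (polyPS (b ∷ p)) f))

quadratic-· : ∀ a b c f k → (polyPS (a ∷ b ∷ c ∷ []) · f) (2 ℕ.+ k) ≡ a * f (2 ℕ.+ k) + (b * f (1 ℕ.+ k) + c * f k)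
quadratic-· a b c f k = trans (·-suc (polyPS (a ∷ b ∷ c ∷ [])) f (suc k)) (cong (_+_ (a * f (2 ℕ.+ k)))
  (trans (·-suc (polyPS (b ∷ c ∷ [])) f k) (cong (_+_ (b * f (1 ℕ.+ k))) ([c]-· c f k))))

D : Poly
D = 1ℚ ∷ ιℤ -[1+ 1 ] ∷ ιℤ -[1+ 2 ] ∷ []

ρ : Poly
ρ = ιℕ 2 ∷ ιℤ -[1+ 2 ] ∷ ιℤ -[1+ 2 ] ∷ []

σ : ℚ → ℚ → Poly
σ m₀ m₁ = ιℕ 2 * m₀ ∷ ιℕ 3 * (m₁ - m₀) ∷ []

module _ (m₀ m₁ : ℚ) where
  private m = seqM m₀ m₁

  -- The coefficient of xⁿ on the left is (n+2) mₙ - (2n+1) mₙ₋₁ - (3n-3) mₙ₋₂, which the recurrence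
  -- annihilates for n ≥ 2. With m₋₁ = m₋₂ = 0 it leaves 2 m₀ and 3 (m₁ - m₀) for n = 0 and 1, which
  -- is the origin of `σ`.
  seqM-ode : polyPS D · θ m ⊕ polyPS ρ · m ≈ polyPS (σ m₀ m₁)
  seqM-ode = coeffs λ
    { zero → trans (cong₂ _+_ (·-zero (polyPS D) (θ m)) (·-zero (polyPS ρ) m)) (solve 1 (λ a → con (+ 1) :* (con (+ 0) :* a) :+ con (+ 2) :* a := con (+ 2) :* a) refl m₀)
    ; (suc zero) → trans
        (cong₂ _+_ (linear-· 1ℚ (ιℤ -[1+ 1 ]) (ιℤ -[1+ 2 ] ∷ []) (θ m)) (linear-· (ιℕ 2) (ιℤ -[1+ 2 ]) (ιℤ -[1+ 2 ] ∷ []) m))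
        (solve 2 (λ a b → (con (+ 1) :* (con (+ 1) :* b) :+ con -[1+ 1 ] :* (con (+ 0) :* a)) :+ (con (+ 2) :* b :+ con -[1+ 2 ] :* a)
                        := con (+ 3) :* (b :- a)) refl m₀ m₁)
    ; (suc (suc k)) → trans (cong₂ _+_ (quadratic-· 1ℚ (ιℤ -[1+ 1 ]) (ιℤ -[1+ 2 ]) (θ m) k) (quadratic-· (ιℕ 2) (ιℤ -[1+ 2 ]) (ιℤ -[1+ 2 ]) m k)) (rec k)
    }
    where
    open ℚ-Solver
    rec : ∀ k → (1ℚ * θ m (2 ℕ.+ k) + (ιℤ -[1+ 1 ] * θ m (1 ℕ.+ k) + ιℤ -[1+ 2 ] * θ m k))
              + (ιℕ 2 * m (2 ℕ.+ k) + (ιℤ -[1+ 2 ] * m (1 ℕ.+ k) + ιℤ -[1+ 2 ] * m k)) ≡ 0ℚ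
    rec k = begin
      (1ℚ * (ιℕ (2 ℕ.+ k) * m (2 ℕ.+ k)) + (ιℤ -[1+ 1 ] * (ιℕ (1 ℕ.+ k) * m (1 ℕ.+ k)) + ιℤ -[1+ 2 ] * (ιℕ k * m k)))
              + (ιℕ 2 * m (2 ℕ.+ k) + (ιℤ -[1+ 2 ] * m (1 ℕ.+ k) + ιℤ -[1+ 2 ] * m k))
        ≡⟨ cong₂ (λ x y → (1ℚ * (x * m (2 ℕ.+ k)) + (ιℤ -[1+ 1 ] * (y * m (1 ℕ.+ k)) + ιℤ -[1+ 2 ] * (ιℕ k * m k)))
              + (ιℕ 2 * m (2 ℕ.+ k) + (ιℤ -[1+ 2 ] * m (1 ℕ.+ k) + ιℤ -[1+ 2 ] * m k))) (ιℕ-homo-+ 2 k) (ιℕ-homo-+ 1 k) ⟩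
      (1ℚ * ((ιℕ 2 + ιℕ k) * m (2 ℕ.+ k)) + (ιℤ -[1+ 1 ] * ((ιℕ 1 + ιℕ k) * m (1 ℕ.+ k)) + ιℤ -[1+ 2 ] * (ιℕ k * m k)))
              + (ιℕ 2 * m (2 ℕ.+ k) + (ιℤ -[1+ 2 ] * m (1 ℕ.+ k) + ιℤ -[1+ 2 ] * m k))
        ≡⟨ solve 4 (λ k a b c →
             (con (+ 1) :* ((con (+ 2) :+ k) :* a) :+ (con -[1+ 1 ] :* ((con (+ 1) :+ k) :* b) :+ con -[1+ 2 ] :* (k :* c)))
               :+ (con (+ 2) :* a :+ (con -[1+ 2 ] :* b :+ con -[1+ 2 ] :* c))
             := (con (+ 4) :+ k) :* a :- ((con (+ 5) :+ con (+ 2) :* k) :* b :+ (con (+ 3) :+ con (+ 3) :* k) :* c))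
             refl (ιℕ k) (m (2 ℕ.+ k)) (m (1 ℕ.+ k)) (m k) ⟩
      (ιℕ 4 + ιℕ k) * m (2 ℕ.+ k) - ((ιℕ 5 + ιℕ 2 * ιℕ k) * m (1 ℕ.+ k) + (ιℕ 3 + ιℕ 3 * ιℕ k) * m k)
        ≡⟨ cong (_- rhs) (seqM-recurrence m₀ m₁ k) ⟩
      rhs - rhs
        ≡⟨ ℚₚ.+-inverseʳ rhs ⟩
      0ℚ ∎
      where
      open ≡-Reasoning
      rhs = (ιℕ 5 + ιℕ 2 * ιℕ k) * m (1 ℕ.+ k) + (ιℕ 3 + ιℕ 3 * ιℕ k) * m k

-- Algebraicity of the Motzkin series

module ≈-Reasoning = Relation.Binary.Reasoning.Setoid PS.setoid

1≢0 : 1ℚ ≢ 0ℚ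
1≢0 ()

-- The coefficient of xⁿ on the left is (n + 2) F n plus multiples of earlier coefficients of F, and
-- n + 2 is never zero.
homogeneous-ode-trivial : ∀ p q F → polyPS (1ℚ ∷ p) · θ F ⊕ polyPS (ιℕ 2 ∷ q) · F ≈ κ 0ℚ → ∀ n → F n ≡ 0ℚ
homogeneous-ode-trivial p q F ode = <-rec (λ n → F n ≡ 0ℚ) λ { zero _ → base ; (suc n) ih → step n (λ k k≤n → ih (s≤s k≤n)) }
  where
  base : F 0 ≡ 0ℚ
  base = *-cancelˡ-≢0 (ιℕ-suc≢0 1) (trans
    (solve 1 (λ a → con (+ 2) :* a := con (+ 1) :* (con (+ 0) :* a) :+ con (+ 2) :* a) refl (F 0))
    (trans (sym (cong₂ _+_ (·-zero (polyPS (1ℚ ∷ p)) (θ F)) (·-zero (polyPS (ιℕ 2 ∷ q)) F))) (trans (coeff ode 0) (sym (ℚₚ.*-zeroʳ (ιℕ 2))))))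
    where open ℚ-Solver
  step : ∀ n → (∀ k → k ℕ.≤ n → F k ≡ 0ℚ) → F (suc n) ≡ 0ℚ
  step n F≡0 = *-cancelˡ-≢0 (ιℕ-suc≢0 (2 ℕ.+ n)) (begin
    ιℕ (3 ℕ.+ n) * F (suc n)
      ≡⟨ cong (_* F (suc n)) (ιℕ-homo-+ 2 (suc n)) ⟩
    (ιℕ 2 + ιℕ (suc n)) * F (suc n)
      ≡⟨ solve 2 (λ k a → (con (+ 2) :+ k) :* a := (con (+ 1) :* (k :* a) :+ con (+ 0)) :+ (con (+ 2) :* a :+ con (+ 0))) refl (ιℕ (suc n)) (F (suc n)) ⟩
    (1ℚ * θ F (suc n) + 0ℚ) + (ιℕ 2 * F (suc n) + 0ℚ)
      ≡⟨ cong₂ (λ x y → (1ℚ * θ F (suc n) + x) + (ιℕ 2 * F (suc n) + y))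
           (·-low (polyPS p) n λ k k≤n → trans (cong (_*_ (ιℕ k)) (F≡0 k k≤n)) (ℚₚ.*-zeroʳ (ιℕ k))) (·-low (polyPS q) n F≡0) ⟨
    (1ℚ * θ F (suc n) + (polyPS p · θ F) n) + (ιℕ 2 * F (suc n) + (polyPS q · F) n)
      ≡⟨ cong₂ _+_ (·-suc (polyPS (1ℚ ∷ p)) (θ F) n) (·-suc (polyPS (ιℕ 2 ∷ q)) F n) ⟨
    (polyPS (1ℚ ∷ p) · θ F ⊕ polyPS (ιℕ 2 ∷ q) · F) (suc n)
      ≡⟨ coeff ode (suc n) ⟩
    0ℚ
      ≡⟨ ℚₚ.*-zeroʳ (ιℕ (3 ℕ.+ n)) ⟨
    ιℕ (3 ℕ.+ n) * 0ℚ ∎)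
    where
    open ≡-Reasoning
    open ℚ-Solver

psPow-zero : ∀ f → psPow f 0 ≈ κ 1ℚ
psPow-zero f = coeffs λ { zero → refl ; (suc n) → refl }

psPow-suc : ∀ f k → psPow f (suc k) ≈ f · psPow f k
psPow-suc f k = ⊛≈· f (psPow f k)

module _ (c : ℚ) where
  private
    M = seqM c c
    K = κ c
    D̂ = ⟦ D ⟧ₚ

  -- The equation 1 + (x - 1) y + x² y² = 0 of the Motzkin generating function, rescaled by y ↦ y /
  -- c and multiplied by c². The top coefficient x² is free of c, so the polynomial is nonzero even
  -- for c = 0.
  motzkinPoly : Poly₂
  motzkinPoly = (c * c ∷ []) ∷ (- c ∷ c ∷ []) ∷ (0ℚ ∷ 0ℚ ∷ 1ℚ ∷ []) ∷ []

  private
    E F θF : PowerSeries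
    E = D̂ · θ M ⊕ ⟦ ρ ⟧ₚ · M ⊕ ⊝ (κ (ιℕ 2) · K)
    F = K · K ⊕ (K · (X ⊕ ⊝ κ 1ℚ)) · M ⊕ (X · X) · (M · M)
    θF = (K · X) · M ⊕ (K · (X ⊕ ⊝ κ 1ℚ)) · θ M ⊕ κ (ιℕ 2) · ((X · X) · (M · M)) ⊕ κ (ιℕ 2) · ((X · X) · (M · θ M))

    E≈0 : E ≈ κ 0ℚ
    E≈0 = begin
      D̂ · θ M ⊕ ⟦ ρ ⟧ₚ · M ⊕ ⊝ (κ (ιℕ 2) · K)
        ≈⟨ PS.+-congʳ (PS.+-cong (PS.*-congʳ (polyPS≈ D)) (PS.*-congʳ (polyPS≈ ρ))) ⟨
      polyPS D · θ M ⊕ polyPS ρ · M ⊕ ⊝ (κ (ιℕ 2) · K)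
        ≈⟨ PS.+-congʳ (seqM-ode c c) ⟩
      polyPS (σ c c) ⊕ ⊝ (κ (ιℕ 2) · K)
        ≈⟨ PS.+-cong lemma (PS.-‿cong (κ-homo-* (ιℕ 2) c)) ⟨
      κ (ιℕ 2 * c) ⊕ ⊝ κ (ιℕ 2 * c)
        ≈⟨ PS.-‿inverseʳ (κ (ιℕ 2 * c)) ⟩
      κ 0ℚ ∎
      where
      open ≈-Reasoning
      lemma : κ (ιℕ 2 * c) ≈ polyPS (σ c c)
      lemma = coeffs λ
        { zero → refl
        ; (suc zero) → sym (trans (cong (_*_ (ιℕ 3)) (ℚₚ.+-inverseʳ c)) (ℚₚ.*-zeroʳ (ιℕ 3)))
        ; (suc (suc n)) → refl }

    θ-F : θ F ≈ θF
    θ-F = begin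
      θ F
        ≈⟨ PS.trans (θ-⊕ (K · K ⊕ (K · X⁻) · M) ((X · X) · (M · M))) (PS.+-congʳ (θ-⊕ (K · K) ((K · X⁻) · M))) ⟩
      θ (K · K) ⊕ θ ((K · X⁻) · M) ⊕ θ ((X · X) · (M · M))
        ≈⟨ PS.+-cong (PS.+-cong θKK (PS.trans (θ-· (K · X⁻) M) (PS.+-congʳ (PS.*-congʳ θKX))))
                     (PS.trans (θ-· (X · X) (M · M)) (PS.+-cong (PS.*-congʳ θXX) (PS.*-congˡ (θ-· M M)))) ⟩
      κ 0ℚ ⊕ ((K · X) · M ⊕ (K · X⁻) · θ M) ⊕ ((X · X ⊕ X · X) · (M · M) ⊕ (X · X) · (θ M · M ⊕ M · θ M))
        ≈⟨ solve 4 (λ k x m n →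
             con (+ 0) :+ (k :* x :* m :+ k :* (x :+ :- con (+ 1)) :* n) :+ ((x :* x :+ x :* x) :* (m :* m) :+ x :* x :* (n :* m :+ m :* n))
             := k :* x :* m :+ k :* (x :+ :- con (+ 1)) :* n :+ con (+ 2) :* (x :* x :* (m :* m)) :+ con (+ 2) :* (x :* x :* (m :* n)))
             PS.refl K X M (θ M) ⟩
      θF ∎
      where
      open ≈-Reasoning
      open PS-Solver
      X⁻ = X ⊕ ⊝ κ 1ℚ
      θKK : θ (K · K) ≈ κ 0ℚ
      θKK = PS.trans (θ-cong (PS.sym (κ-homo-* c c))) (θ-κ (c * c))
      θX⁻ : θ X⁻ ≈ X
      θX⁻ = PS.trans (θ-⊕ X (⊝ κ 1ℚ)) (PS.trans (PS.+-cong θ-X (PS.trans (θ-cong (PS.sym (κ-homo‿- 1ℚ))) (θ-κ (- 1ℚ)))) (PS.+-identityʳ X))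
      θKX : θ (K · X⁻) ≈ K · X
      θKX = PS.trans (θ-· K X⁻) (PS.trans (PS.+-cong (PS.trans (PS.*-congʳ (θ-κ c)) (PS.zeroˡ X⁻)) (PS.*-congˡ θX⁻)) (PS.+-identityˡ (K · X)))
      θXX : θ (X · X) ≈ X · X ⊕ X · X
      θXX = PS.trans (θ-· X X) (PS.+-cong (PS.*-congʳ θ-X) (PS.*-congˡ θ-X))

    -- By the chain rule θM enters θF only through (∂F/∂M) θM. The left side is therefore (∂F/∂M)
    -- times `E`, with ∂F/∂M = c (x - 1) + 2 x² M.
    F-ode : polyPS D · θ F ⊕ polyPS (ιℕ 2 ∷ ιℤ -[1+ 1 ] ∷ []) · F ≈ κ 0ℚ
    F-ode = begin
      polyPS D · θ F ⊕ polyPS (ιℕ 2 ∷ ιℤ -[1+ 1 ] ∷ []) · F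
        ≈⟨ PS.+-cong (PS.*-cong (polyPS≈ D) θ-F) (PS.*-congʳ (polyPS≈ (ιℕ 2 ∷ ιℤ -[1+ 1 ] ∷ []))) ⟩
      D̂ · θF ⊕ ⟦ ιℕ 2 ∷ ιℤ -[1+ 1 ] ∷ [] ⟧ₚ · F
        ≈⟨ solve 4 (λ k x m n →
             let d = con (+ 1) :+ x :* (con -[1+ 1 ] :+ x :* (con -[1+ 2 ] :+ x :* con (+ 0)))
                 r = con (+ 2) :+ x :* (con -[1+ 2 ] :+ x :* (con -[1+ 2 ] :+ x :* con (+ 0)))
                 y = x :+ :- con (+ 1)
             in d :* (k :* x :* m :+ k :* y :* n :+ con (+ 2) :* (x :* x :* (m :* m)) :+ con (+ 2) :* (x :* x :* (m :* n)))
                  :+ (con (+ 2) :+ x :* (con -[1+ 1 ] :+ x :* con (+ 0))) :* (k :* k :+ k :* y :* m :+ x :* x :* (m :* m))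
                := (k :* y :+ con (+ 2) :* (x :* x :* m)) :* (d :* n :+ r :* m :+ :- (con (+ 2) :* k)))
             PS.refl K X M (θ M) ⟩
      (K · (X ⊕ ⊝ κ 1ℚ) ⊕ κ (ιℕ 2) · ((X · X) · M)) · E
        ≈⟨ PS.trans (PS.*-congˡ E≈0) (PS.zeroʳ _) ⟩
      κ 0ℚ ∎
      where
      open ≈-Reasoning
      open PS-Solver

    evalAt≈F : ∀ n → evalAt motzkinPoly M n ≡ F n
    evalAt≈F = coeff (begin
      polyPS (c * c ∷ []) ⊛ psPow M 0 ⊕ (polyPS (- c ∷ c ∷ []) ⊛ psPow M 1 ⊕ (polyPS (0ℚ ∷ 0ℚ ∷ 1ℚ ∷ []) ⊛ psPow M 2 ⊕ (λ _ → 0ℚ)))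
        ≈⟨ PS.+-cong (⊛≈· _ _) (PS.+-cong (⊛≈· _ _) (PS.+-cong (⊛≈· _ _) (polyPS≈ []))) ⟩
      polyPS (c * c ∷ []) · psPow M 0 ⊕ (polyPS (- c ∷ c ∷ []) · psPow M 1 ⊕ (polyPS (0ℚ ∷ 0ℚ ∷ 1ℚ ∷ []) · psPow M 2 ⊕ κ 0ℚ))
        ≈⟨ PS.+-cong (PS.*-cong (PS.trans (polyPS≈ (c * c ∷ [])) (PS.+-congʳ (κ-homo-* c c))) (psPow-zero M))
          (PS.+-cong (PS.*-cong (PS.trans (polyPS≈ (- c ∷ c ∷ [])) (PS.+-congʳ (κ-homo‿- c))) (PS.trans (psPow-suc M 0) (PS.*-congˡ (psPow-zero M))))
          (PS.+-congʳ (PS.*-cong (polyPS≈ (0ℚ ∷ 0ℚ ∷ 1ℚ ∷ [])) (PS.trans (psPow-suc M 1) (PS.*-congˡ (PS.trans (psPow-suc M 0) (PS.*-congˡ (psPow-zero M)))))))) ⟩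
      (K · K ⊕ X · κ 0ℚ) · κ 1ℚ ⊕ ((⊝ K ⊕ X · (K ⊕ X · κ 0ℚ)) · (M · κ 1ℚ) ⊕ (⟦ 0ℚ ∷ 0ℚ ∷ 1ℚ ∷ [] ⟧ₚ · (M · (M · κ 1ℚ)) ⊕ κ 0ℚ))
        ≈⟨ solve 3 (λ k x m →
             (k :* k :+ x :* con (+ 0)) :* con (+ 1) :+ ((:- k :+ x :* (k :+ x :* con (+ 0))) :* (m :* con (+ 1))
               :+ ((con (+ 0) :+ x :* (con (+ 0) :+ x :* (con (+ 1) :+ x :* con (+ 0)))) :* (m :* (m :* con (+ 1))) :+ con (+ 0)))
             := k :* k :+ k :* (x :+ :- con (+ 1)) :* m :+ x :* x :* (m :* m)) PS.refl K X M ⟩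
      F ∎)
      where
      open ≈-Reasoning
      open PS-Solver

  seqM-algebraic : Algebraic (seqM c c)
  seqM-algebraic = motzkinPoly , there (there (here (there (there (here 1≢0))))) , λ n →
    trans (evalAt≈F n) (homogeneous-ode-trivial (ιℤ -[1+ 1 ] ∷ ιℤ -[1+ 2 ] ∷ []) (ιℤ -[1+ 1 ] ∷ []) F F-ode n)

-- Non-algebraicity for m₀ ≠ m₁

κ-const : ∀ f → (∀ n → f (suc n) ≡ 0ℚ) → f ≈ κ (f 0)
κ-const f tail≡0 = coeffs λ { zero → refl ; (suc n) → tail≡0 n }

Deg≤ : ℕ → PowerSeries → Set
Deg≤ d f = ∀ n → d ℕ.< n → f n ≡ 0ℚ

HasDegree : ℕ → PowerSeries → Set
HasDegree d f = f d ≢ 0ℚ × Deg≤ d f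

-- Polynomials are series that vanish beyond some index, not coefficient lists: the coefficients
-- produced by the descent then stay in `PS`, where its ring solver applies.
IsPoly : PowerSeries → Set
IsPoly f = ∃ λ d → Deg≤ d f

deg-mono : ∀ {d e} f → d ℕ.≤ e → Deg≤ d f → Deg≤ e f
deg-mono f d≤e df n e<n = df n (ℕₚ.≤-<-trans d≤e e<n)

deg-⊕ : ∀ {d} f g → Deg≤ d f → Deg≤ d g → Deg≤ d (f ⊕ g)
deg-⊕ f g df dg n d<n = cong₂ _+_ (df n d<n) (dg n d<n)

deg-⊝ : ∀ {d} f → Deg≤ d f → Deg≤ d (⊝ f)
deg-⊝ f df n d<n = cong -_ (df n d<n)

deg-θ : ∀ {d} f → Deg≤ d f → Deg≤ d (θ f)
deg-θ f df n d<n = trans (cong (_*_ (ιℕ n)) (df n d<n)) (ℚₚ.*-zeroʳ (ιℕ n))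

deg-κ : ∀ c → Deg≤ 0 (κ c)
deg-κ c (suc n) _ = refl

deg-polyPS : ∀ p → Deg≤ (length p) (polyPS p)
deg-polyPS []       n       _         = refl
deg-polyPS (c ∷ cs) (suc n) (s≤s l<n) = deg-polyPS cs n l<n

const-· : ∀ f g → Deg≤ 0 f → ∀ n → (f · g) n ≡ f 0 * g n
const-· f g df n = trans (coeff (PS.*-congʳ (κ-const f λ k → df (suc k) (s≤s z≤n))) n) (κ-· (f 0) g n)

deg-· : ∀ d {e} f g → Deg≤ d f → Deg≤ e g → Deg≤ (d ℕ.+ e) (f · g)
deg-· zero    f g df dg n e<n = trans (const-· f g df n) (trans (cong (_*_ (f 0)) (dg n e<n)) (ℚₚ.*-zeroʳ (f 0)))
deg-· (suc d) {e} f g df dg (suc n) (s≤s d+e<n) = trans (·-suc f g n) (cong₂ _+_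
  (trans (cong (_*_ (f 0)) (dg (suc n) (s≤s (ℕₚ.≤-trans (ℕₚ.m≤n+m e d) (ℕₚ.<⇒≤ d+e<n))))) (ℚₚ.*-zeroʳ (f 0)))
  (deg-· d (tail f) g (λ k d<k → df (suc k) (s≤s d<k)) dg n d+e<n))

lead-· : ∀ d e f g → Deg≤ d f → Deg≤ e g → (f · g) (d ℕ.+ e) ≡ f d * g e
lead-· zero    e f g df dg = const-· f g df e
lead-· (suc d) e f g df dg = trans (·-suc f g (d ℕ.+ e)) (trans (cong₂ _+_
  (trans (cong (_*_ (f 0)) (dg (suc (d ℕ.+ e)) (s≤s (ℕₚ.m≤n+m e d)))) (ℚₚ.*-zeroʳ (f 0)))
  (lead-· d e (tail f) g (λ k d<k → df (suc k) (s≤s d<k)) dg)) (ℚₚ.+-identityˡ _))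

poly-⊕ : ∀ {f g} → IsPoly f → IsPoly g → IsPoly (f ⊕ g)
poly-⊕ {f} {g} (d , df) (e , dg) = d ℕ.⊔ e ,
  deg-⊕ f g (deg-mono f (ℕₚ.m≤m⊔n d e) df) (deg-mono g (ℕₚ.m≤n⊔m d e) dg)

poly-⊝ : ∀ {f} → IsPoly f → IsPoly (⊝ f)
poly-⊝ {f} (d , df) = d , deg-⊝ f df

poly-θ : ∀ {f} → IsPoly f → IsPoly (θ f)
poly-θ {f} (d , df) = d , deg-θ f df

poly-· : ∀ {f g} → IsPoly f → IsPoly g → IsPoly (f · g)
poly-· {f} {g} (d , df) (e , dg) = d ℕ.+ e , deg-· d f g df dg

poly-κ : ∀ c → IsPoly (κ c)
poly-κ c = 0 , deg-κ c

poly-polyPS : ∀ p → IsPoly (polyPS p)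
poly-polyPS p = length p , deg-polyPS p

degree : ∀ f → IsPoly f → (∀ n → f n ≡ 0ℚ) ⊎ ∃ λ d → HasDegree d f
degree f (d , df) = search d df
  where
  search : ∀ d → Deg≤ d f → (∀ n → f n ≡ 0ℚ) ⊎ ∃ λ d → HasDegree d f
  search d df with f d ≟ 0ℚ
  search d       df | no  fd≢0 = inj₂ (d , fd≢0 , df)
  search zero    df | yes f0≡0 = inj₁ λ { zero → f0≡0 ; (suc n) → df (suc n) (s≤s z≤n) }
  search (suc d) df | yes fd≡0 = search d λ n d<n → case n d<n (ℕₚ.m≤n⇒m<n∨m≡n d<n)
    where
    case : ∀ n → d ℕ.< n → suc d ℕ.< n ⊎ suc d ≡ n → f n ≡ 0ℚ
    case n _ (inj₁ d<n)  = df n d<n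
    case n _ (inj₂ refl) = fd≡0

-- This is −k a² (D θu + ρ u − σ) for the rational function u = −b / (k a).
rationalDefect : (m₀ m₁ : ℚ) → ℕ → PowerSeries → PowerSeries → PowerSeries
rationalDefect m₀ m₁ k a b =
  polyPS D · (a · θ b ⊕ ⊝ (θ a · b)) ⊕ polyPS ρ · (a · b) ⊕ κ (ιℕ k) · (polyPS (σ m₀ m₁) · (a · a))

module _ (m₀ m₁ : ℚ) (m₁-m₀≢0 : m₁ - m₀ ≢ 0ℚ) (k : ℕ) where
  private
    s = σ m₀ m₁

    deg-D : Deg≤ 2 (polyPS D)
    deg-D (suc (suc (suc n))) _ = refl
    deg-D (suc (suc zero)) (s≤s (s≤s ()))
    deg-D (suc zero) (s≤s ())

    deg-ρ : Deg≤ 2 (polyPS ρ)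
    deg-ρ (suc (suc (suc n))) _ = refl
    deg-ρ (suc (suc zero)) (s≤s (s≤s ()))
    deg-ρ (suc zero) (s≤s ())

    deg-s : Deg≤ 1 (polyPS s)
    deg-s (suc (suc n)) _ = refl
    deg-s (suc zero) (s≤s ())

  module _ {a b : PowerSeries} {α : ℕ} (a-deg : HasDegree α a) where
    private
      aα≢0 = proj₁ a-deg
      da   = proj₂ a-deg
      ksaa = κ (ιℕ (suc k)) · (polyPS s · (a · a))

      deg-ksaa : Deg≤ (1 ℕ.+ (α ℕ.+ α)) ksaa
      deg-ksaa = deg-· 0 (κ (ιℕ (suc k))) (polyPS s · (a · a)) (deg-κ _) (deg-· 1 (polyPS s) (a · a) deg-s (deg-· α a a da da))

      lead-ksaa : ksaa (1 ℕ.+ (α ℕ.+ α)) ≡ ιℕ (suc k) * (ιℕ 3 * (m₁ - m₀) * (a α * a α))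
      lead-ksaa = trans (κ-· (ιℕ (suc k)) (polyPS s · (a · a)) (1 ℕ.+ (α ℕ.+ α))) (cong (_*_ (ιℕ (suc k)))
        (trans (lead-· 1 (α ℕ.+ α) (polyPS s) (a · a) deg-s (deg-· α a a da da)) (cong (_*_ (ιℕ 3 * (m₁ - m₀))) (lead-· α α a a da da))))

      lead-ksaa≢0 : ιℕ (suc k) * (ιℕ 3 * (m₁ - m₀) * (a α * a α)) ≢ 0ℚ
      lead-ksaa≢0 = *-≢0 (ιℕ-suc≢0 k) (*-≢0 (*-≢0 (ιℕ-suc≢0 2) m₁-m₀≢0) (*-≢0 aα≢0 aα≢0))

      -- `D` and `ρ` both lead with -3x². In the factor 1 + β - α, the 1 comes from `ρ`, the β from
      -- θ b, and the -α from θ a.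
      lead-homogeneous : ∀ β → Deg≤ β b →
        (polyPS D · (a · θ b ⊕ ⊝ (θ a · b)) ⊕ polyPS ρ · (a · b)) (2 ℕ.+ (α ℕ.+ β))
        ≡ (ιℤ -[1+ 2 ] * ((1ℚ + ιℕ β) + - ιℕ α)) * (a α * b β)
      lead-homogeneous β db = begin
        (polyPS D · W) (2 ℕ.+ (α ℕ.+ β)) + (polyPS ρ · (a · b)) (2 ℕ.+ (α ℕ.+ β))
          ≡⟨ cong₂ _+_ (lead-· 2 (α ℕ.+ β) (polyPS D) W deg-D (deg-⊕ (a · θ b) (⊝ (θ a · b)) (deg-· α a (θ b) da dθb) (deg-⊝ (θ a · b) (deg-· α (θ a) b dθa db))))
                       (lead-· 2 (α ℕ.+ β) (polyPS ρ) (a · b) deg-ρ (deg-· α a b da db)) ⟩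
        ιℤ -[1+ 2 ] * ((a · θ b) (α ℕ.+ β) + - (θ a · b) (α ℕ.+ β)) + ιℤ -[1+ 2 ] * (a · b) (α ℕ.+ β)
          ≡⟨ cong₂ (λ x y → ιℤ -[1+ 2 ] * x + ιℤ -[1+ 2 ] * y)
               (cong₂ (λ x y → x + - y) (lead-· α β a (θ b) da dθb) (lead-· α β (θ a) b dθa db)) (lead-· α β a b da db) ⟩
        ιℤ -[1+ 2 ] * (a α * (ιℕ β * b β) + - (ιℕ α * a α * b β)) + ιℤ -[1+ 2 ] * (a α * b β)
          ≡⟨ solve 4 (λ a b i j → con -[1+ 2 ] :* (a :* (j :* b) :+ :- (i :* a :* b)) :+ con -[1+ 2 ] :* (a :* b)
                := (con -[1+ 2 ] :* ((con (+ 1) :+ j) :+ :- i)) :* (a :* b)) refl (a α) (b β) (ιℕ α) (ιℕ β) ⟩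
        (ιℤ -[1+ 2 ] * ((1ℚ + ιℕ β) + - ιℕ α)) * (a α * b β) ∎
        where
        open ≡-Reasoning
        open ℚ-Solver
        W   = a · θ b ⊕ ⊝ (θ a · b)
        dθa = deg-θ a da
        dθb = deg-θ b db

      low-degree : (polyPS D · (a · θ b ⊕ ⊝ (θ a · b)) ⊕ polyPS ρ · (a · b)) (1 ℕ.+ (α ℕ.+ α)) ≡ 0ℚ →
        ∃ λ n → rationalDefect m₀ m₁ (suc k) a b n ≢ 0ℚ
      low-degree eq = 1 ℕ.+ (α ℕ.+ α) , λ eq′ → lead-ksaa≢0 (trans (sym (trans (cong₂ _+_ eq lead-ksaa) (ℚₚ.+-identityˡ _))) eq′)

    -- The source term has exact degree 1 + 2α. If α ≤ β, the homogeneous part has the larger degree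
    -- 2 + α + β, with nonzero factor 1 + β - α. If β < α, it can reach degree 1 + 2α only for β = α
    -- - 1, where that factor vanishes, so the source term survives.
    rationalDefect≢0 : IsPoly b → ∃ λ n → rationalDefect m₀ m₁ (suc k) a b n ≢ 0ℚ
    rationalDefect≢0 b-poly with degree b b-poly
    ... | inj₁ b≡0 = low-degree (cong₂ _+_
      (·-low (polyPS D) _ λ n _ → cong₂ (λ x y → x + - y) (·-low a n λ i _ → trans (cong (_*_ (ιℕ i)) (b≡0 i)) (ℚₚ.*-zeroʳ (ιℕ i))) (·-low (θ a) n λ i _ → b≡0 i))
      (·-low (polyPS ρ) _ λ n _ → ·-low a n λ i _ → b≡0 i))
    ... | inj₂ (β , bβ≢0 , db) with α ℕ.≤? β
    ...   | yes α≤β = 2 ℕ.+ (α ℕ.+ β) , λ eq → *-≢0 (*-≢0 -3≢0 gap≢0) (*-≢0 aα≢0 bβ≢0) (trans (sym (trans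
                        (cong₂ _+_ (lead-homogeneous β db) (deg-ksaa (2 ℕ.+ (α ℕ.+ β)) (s≤s (s≤s (ℕₚ.+-monoʳ-≤ α α≤β)))))
                        (ℚₚ.+-identityʳ _))) eq)
      where
      -3≢0 : ιℤ -[1+ 2 ] ≢ 0ℚ
      -3≢0 ()
      gap≢0 : (1ℚ + ιℕ β) + - ιℕ α ≢ 0ℚ
      gap≢0 eq = ℕₚ.<⇒≢ (s≤s α≤β) (ιℕ-injective (begin
        ιℕ α                               ≡⟨ ℚₚ.+-identityˡ (ιℕ α) ⟨
        0ℚ + ιℕ α                          ≡⟨ cong (_+ ιℕ α) eq ⟨
        ((1ℚ + ιℕ β) + - ιℕ α) + ιℕ α      ≡⟨ solve 2 (λ i j → ((con (+ 1) :+ j) :+ :- i) :+ i := con (+ 1) :+ j) refl (ιℕ α) (ιℕ β) ⟩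
        1ℚ + ιℕ β                          ≡⟨ ιℕ-suc β ⟨
        ιℕ (suc β)                         ∎))
        where
        open ≡-Reasoning
        open ℚ-Solver
    ...   | no  α≰β = low-degree (cancel α (ℕₚ.≰⇒> α≰β) (λ γ → lead-homogeneous γ))
      where
      H = polyPS D · (a · θ b ⊕ ⊝ (θ a · b)) ⊕ polyPS ρ · (a · b)
      -- Reading `b` as a series of degree at most γ = α - 1 treats all β < α at once: the
      -- coefficient in degree 2 + α + γ = 1 + 2α carries the factor 1 + γ - α = 0.
      cancel : ∀ α → β ℕ.< α → (∀ γ → Deg≤ γ b → H (2 ℕ.+ (α ℕ.+ γ)) ≡ (ιℤ -[1+ 2 ] * ((1ℚ + ιℕ γ) + - ιℕ α)) * (a α * b γ)) →
        H (1 ℕ.+ (α ℕ.+ α)) ≡ 0ℚ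
      cancel (suc γ) (s≤s β≤γ) lead = begin
        H (1 ℕ.+ (suc γ ℕ.+ suc γ))
          ≡⟨ cong (λ n → H (1 ℕ.+ n)) (ℕₚ.+-suc (suc γ) γ) ⟩
        H (2 ℕ.+ (suc γ ℕ.+ γ))
          ≡⟨ lead γ (deg-mono b β≤γ db) ⟩
        (ιℤ -[1+ 2 ] * ((1ℚ + ιℕ γ) + - ιℕ (suc γ))) * (a (suc γ) * b γ)
          ≡⟨ cong (λ x → (ιℤ -[1+ 2 ] * ((1ℚ + ιℕ γ) + - x)) * (a (suc γ) * b γ)) (ιℕ-suc γ) ⟩
        (ιℤ -[1+ 2 ] * ((1ℚ + ιℕ γ) + - (1ℚ + ιℕ γ))) * (a (suc γ) * b γ)
          ≡⟨ solve 2 (λ x y → (con -[1+ 2 ] :* (x :+ :- x)) :* y := con (+ 0)) refl (1ℚ + ιℕ γ) (a (suc γ) * b γ) ⟩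
        0ℚ ∎
        where
        open ≡-Reasoning
        open ℚ-Solver

-- Descent on the degree of a polynomial relation.

⊕-congˡ : ∀ f {g h} → g ≈ h → f ⊕ g ≈ f ⊕ h
⊕-congˡ f = PS.+-cong (PS.refl {f})

·-congˡ : ∀ f {g h} → g ≈ h → f · g ≈ f · h
·-congˡ f = PS.*-cong (PS.refl {f})

·-congʳ : ∀ f {g h} → g ≈ h → g · f ≈ h · f
·-congʳ f e = PS.*-cong e (PS.refl {f})

-- `A` is a total sequence of which only the entries up to the bound count, so derived coefficients
-- may mention `A (suc i)` without a range condition.
evalUpTo : (ℕ → PowerSeries) → PowerSeries → ℕ → PowerSeries
evalUpTo A f zero    = A 0 · psPow f 0
evalUpTo A f (suc d) = evalUpTo A f d ⊕ A (suc d) · psPow f (suc d)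

module _ (m₀ m₁ : ℚ) where
  private
    m = seqM m₀ m₁
    D̂ = polyPS D
    ρ̂ = polyPS ρ
    s = polyPS (σ m₀ m₁)
    N : ℕ → PowerSeries
    N i = κ (ιℕ i)

    N-suc : ∀ i → N (suc i) ≈ κ 1ℚ ⊕ N i
    N-suc i = PS.trans (PS.reflexive (cong κ (ιℕ-suc i))) (κ-homo-+ 1ℚ (ιℕ i))

    Dθm : D̂ · θ m ≈ s ⊕ ⊝ (ρ̂ · m)
    Dθm = PS.trans (solve 2 (λ x y → x := (x :+ y) :+ :- y) PS.refl (D̂ · θ m) (ρ̂ · m)) (PS.+-congʳ (seqM-ode m₀ m₁))
      where open PS-Solver

    -- Chain rule, with D θm replaced by s - ρ m. Consequently D θ does not raise the degree in m,
    -- which makes an elimination against the original relation possible.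
    Dθ-pow : ∀ i → D̂ · θ (psPow m (suc i)) ≈ N (suc i) · (s · psPow m i ⊕ ⊝ (ρ̂ · psPow m (suc i)))
    Dθ-pow zero = begin
      D̂ · θ (psPow m 1)
        ≈⟨ PS.*-congˡ (θ-cong m¹) ⟩
      D̂ · θ m
        ≈⟨ Dθm ⟩
      s ⊕ ⊝ (ρ̂ · m)
        ≈⟨ solve 3 (λ s r m → s :+ :- (r :* m) := con (+ 1) :* (s :* con (+ 1) :+ :- (r :* m))) PS.refl s ρ̂ m ⟩
      N 1 · (s · κ 1ℚ ⊕ ⊝ (ρ̂ · m))
        ≈⟨ PS.*-congˡ (PS.+-cong (PS.*-congˡ (psPow-zero m)) (PS.-‿cong (PS.*-congˡ m¹))) ⟨
      N 1 · (s · psPow m 0 ⊕ ⊝ (ρ̂ · psPow m 1)) ∎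
      where
      open ≈-Reasoning
      open PS-Solver
      m¹ : psPow m 1 ≈ m
      m¹ = PS.trans (psPow-suc m 0) (PS.trans (PS.*-congˡ (psPow-zero m)) (PS.*-identityʳ m))
    Dθ-pow (suc i) = begin
      D̂ · θ (psPow m (2 ℕ.+ i))
        ≈⟨ PS.*-congˡ (PS.trans (θ-cong (psPow-suc m (suc i))) (θ-· m q)) ⟩
      D̂ · (θ m · q ⊕ m · θ q)
        ≈⟨ solve 5 (λ d m n q r → d :* (n :* q :+ m :* r) := (d :* n) :* q :+ m :* (d :* r)) PS.refl D̂ m (θ m) q (θ q) ⟩
      (D̂ · θ m) · q ⊕ m · (D̂ · θ q)
        ≈⟨ PS.+-cong (PS.*-congʳ Dθm) (PS.*-congˡ (Dθ-pow i)) ⟩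
      (s ⊕ ⊝ (ρ̂ · m)) · q ⊕ m · (N (suc i) · (s · p ⊕ ⊝ (ρ̂ · q)))
        ≈⟨ solve 6 (λ s r m q p n → (s :+ :- (r :* m)) :* q :+ m :* (n :* (s :* p :+ :- (r :* q)))
             := (s :* q :+ :- (r :* (m :* q))) :+ n :* (s :* (m :* p) :+ :- (r :* (m :* q)))) PS.refl s ρ̂ m q p (N (suc i)) ⟩
      (s · q ⊕ ⊝ (ρ̂ · (m · q))) ⊕ N (suc i) · (s · (m · p) ⊕ ⊝ (ρ̂ · (m · q)))
        ≈⟨ ⊕-congˡ (s · q ⊕ ⊝ (ρ̂ · (m · q))) (·-congˡ (N (suc i)) (PS.+-cong (·-congˡ s (psPow-suc m i)) (PS.refl {⊝ (ρ̂ · (m · q))}))) ⟨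
      (s · q ⊕ ⊝ (ρ̂ · (m · q))) ⊕ N (suc i) · (s · q ⊕ ⊝ (ρ̂ · (m · q)))
        ≈⟨ solve 2 (λ x n → x :+ n :* x := (con (+ 1) :+ n) :* x) PS.refl (s · q ⊕ ⊝ (ρ̂ · (m · q))) (N (suc i)) ⟩
      (κ 1ℚ ⊕ N (suc i)) · (s · q ⊕ ⊝ (ρ̂ · (m · q)))
        ≈⟨ PS.*-cong (N-suc (suc i)) (⊕-congˡ (s · q) (PS.-‿cong (·-congˡ ρ̂ (psPow-suc m (suc i))))) ⟨
      N (2 ℕ.+ i) · (s · q ⊕ ⊝ (ρ̂ · psPow m (2 ℕ.+ i))) ∎
      where
      open ≈-Reasoning
      open PS-Solver
      p = psPow m i
      q = psPow m (suc i)

  module _ (A : ℕ → PowerSeries) where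
    private
      -- `A° i` is the coefficient of mⁱ after applying D θ to the relation: `B i` stems from A i ·
      -- mⁱ and the other summand from A (suc i) · mⁱ⁺¹.
      B A° : ℕ → PowerSeries
      B  i = D̂ · θ (A i) ⊕ ⊝ (N i · (ρ̂ · A i))
      A° i = B i ⊕ N (suc i) · (s · A (suc i))

      -- D θ of the truncated relation. Nothing lies above the highest power of m, so its
      -- coefficient is `B`, not `A°`.
      top : ℕ → PowerSeries
      top zero    = B 0 · psPow m 0
      top (suc d) = evalUpTo A° m d ⊕ B (suc d) · psPow m (suc d)

      E-A° : ∀ d → evalUpTo A° m d ≈ top d ⊕ (N (suc d) · (s · A (suc d))) · psPow m d
      E-A° zero    = PS.distribʳ (psPow m 0) (B 0) (N 1 · (s · A 1))
      E-A° (suc d) = PS.trans (⊕-congˡ (evalUpTo A° m d) (PS.distribʳ q (B (suc d)) r)) (PS.sym (PS.+-assoc (evalUpTo A° m d) (B (suc d) · q) (r · q)))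
        where
        q = psPow m (suc d)
        r = N (2 ℕ.+ d) · (s · A (2 ℕ.+ d))

      Dθ-E : ∀ d → D̂ · θ (evalUpTo A m d) ≈ top d
      Dθ-E zero = begin
        D̂ · θ (A 0 · psPow m 0)
          ≈⟨ PS.*-congˡ (θ-cong (PS.trans (PS.*-congˡ (psPow-zero m)) (PS.*-identityʳ (A 0)))) ⟩
        D̂ · θ (A 0)
          ≈⟨ solve 4 (λ d a r b → d :* a := (d :* a :+ :- (con (+ 0) :* (r :* b))) :* con (+ 1)) PS.refl D̂ (θ (A 0)) ρ̂ (A 0) ⟩
        B 0 · κ 1ℚ
          ≈⟨ PS.*-congˡ (psPow-zero m) ⟨
        B 0 · psPow m 0 ∎
        where
        open ≈-Reasoning
        open PS-Solver
      Dθ-E (suc d) = begin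
        D̂ · θ (evalUpTo A m d ⊕ a · q)
          ≈⟨ ·-congˡ D̂ (PS.trans (θ-⊕ (evalUpTo A m d) (a · q)) (⊕-congˡ (θ (evalUpTo A m d)) (θ-· a q))) ⟩
        D̂ · (θ (evalUpTo A m d) ⊕ (θ a · q ⊕ a · θ q))
          ≈⟨ solve 6 (λ d e a b q r → d :* (e :+ (b :* q :+ a :* r)) := d :* e :+ ((d :* b) :* q :+ a :* (d :* r))) PS.refl D̂ (θ (evalUpTo A m d)) a (θ a) q (θ q) ⟩
        D̂ · θ (evalUpTo A m d) ⊕ ((D̂ · θ a) · q ⊕ a · (D̂ · θ q))
          ≈⟨ PS.+-cong (Dθ-E d) (⊕-congˡ ((D̂ · θ a) · q) (·-congˡ a (Dθ-pow d))) ⟩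
        top d ⊕ ((D̂ · θ a) · q ⊕ a · (n · (s · p ⊕ ⊝ (ρ̂ · q))))
          ≈⟨ solve 8 (λ t d a q n s p r → t :+ (d :* q :+ a :* (n :* (s :* p :+ :- (r :* q))))
               := (t :+ (n :* (s :* a)) :* p) :+ (d :+ :- (n :* (r :* a))) :* q) PS.refl (top d) (D̂ · θ a) a q n s p ρ̂ ⟩
        (top d ⊕ (n · (s · a)) · p) ⊕ B (suc d) · q
          ≈⟨ PS.+-congʳ (E-A° d) ⟨
        evalUpTo A° m d ⊕ B (suc d) · q ∎
        where
        open ≈-Reasoning
        open PS-Solver
        a = A (suc d)
        n = N (suc d)
        p = psPow m d
        q = psPow m (suc d)

    -- Cross-multiplication by leading coefficients: A (suc d) times the differentiated relation
    -- minus B (suc d) times the relation itself, so that the power suc d of m cancels.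
    derived : ℕ → ℕ → PowerSeries
    derived d i = A (suc d) · A° i ⊕ ⊝ (B (suc d) · A i)

    derived-poly : (∀ i → IsPoly (A i)) → ∀ d i → IsPoly (derived d i)
    derived-poly A-poly d i = poly-⊕ (poly-· (A-poly (suc d)) (poly-⊕ (B-poly i) (poly-· (poly-κ _) (poly-· (poly-polyPS (σ m₀ m₁)) (A-poly (suc i))))))
      (poly-⊝ (poly-· (B-poly (suc d)) (A-poly i)))
      where
      B-poly : ∀ i → IsPoly (B i)
      B-poly i = poly-⊕ (poly-· (poly-polyPS D) (poly-θ (A-poly i))) (poly-⊝ (poly-· (poly-κ _) (poly-· (poly-polyPS ρ) (A-poly i))))

    -- The ρ-terms of the two coefficients carry the weights d and d + 1; their difference 1 leaves
    -- `ρ` unscaled, as in the differential equation for the mean of the conjugates.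
    derived-top : ∀ d → derived d d ≈ rationalDefect m₀ m₁ (suc d) (A (suc d)) (A d)
    derived-top d = begin
      a · ((D̂ · θ b ⊕ ⊝ (n · (ρ̂ · b))) ⊕ n⁺ · (s · a)) ⊕ ⊝ ((D̂ · θ a ⊕ ⊝ (n⁺ · (ρ̂ · a))) · b)
        ≈⟨ solve 9 (λ d n n⁺ r s a b a′ b′ →
             a :* ((d :* b′ :+ :- (n :* (r :* b))) :+ n⁺ :* (s :* a)) :+ :- ((d :* a′ :+ :- (n⁺ :* (r :* a))) :* b)
             := (d :* (a :* b′ :+ :- (a′ :* b)) :+ (n⁺ :+ :- n) :* (r :* (a :* b))) :+ n⁺ :* (s :* (a :* a)))
             PS.refl D̂ n n⁺ ρ̂ s a b (θ a) (θ b) ⟩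
      (D̂ · (a · θ b ⊕ ⊝ (θ a · b)) ⊕ (n⁺ ⊕ ⊝ n) · (ρ̂ · (a · b))) ⊕ n⁺ · (s · (a · a))
        ≈⟨ PS.+-cong (⊕-congˡ (D̂ · (a · θ b ⊕ ⊝ (θ a · b))) (PS.trans (·-congʳ (ρ̂ · (a · b)) n⁺-n) (PS.*-identityˡ (ρ̂ · (a · b)))))
             (PS.refl {n⁺ · (s · (a · a))}) ⟩
      rationalDefect m₀ m₁ (suc d) a b ∎
      where
      open ≈-Reasoning
      open PS-Solver
      a  = A (suc d)
      b  = A d
      n  = N d
      n⁺ = N (suc d)
      n⁺-n : n⁺ ⊕ ⊝ n ≈ κ 1ℚ
      n⁺-n = PS.trans (PS.+-cong (N-suc d) (PS.refl {⊝ n})) (solve 1 (λ n → (con (+ 1) :+ n) :+ :- n := con (+ 1)) PS.refl n)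

    E-derived : ∀ d → evalUpTo A m (suc d) ≈ κ 0ℚ → evalUpTo (derived d) m d ≈ κ 0ℚ
    E-derived d E≈0 = begin
      evalUpTo (derived d) m d
        ≈⟨ linear d ⟩
      a · evalUpTo A° m d ⊕ ⊝ (b · evalUpTo A m d)
        ≈⟨ solve 5 (λ a b e f q → a :* e :+ :- (b :* f) := a :* (e :+ b :* q) :+ :- (b :* (f :+ a :* q))) PS.refl a b (evalUpTo A° m d) (evalUpTo A m d) (psPow m (suc d)) ⟩
      a · (evalUpTo A° m d ⊕ b · psPow m (suc d)) ⊕ ⊝ (b · evalUpTo A m (suc d))
        ≈⟨ PS.+-cong (PS.*-congˡ (Dθ-E (suc d))) PS.refl ⟨
      a · (D̂ · θ (evalUpTo A m (suc d))) ⊕ ⊝ (b · evalUpTo A m (suc d))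
        ≈⟨ PS.+-cong (PS.*-congˡ (PS.*-congˡ (PS.trans (θ-cong E≈0) (θ-κ 0ℚ)))) (PS.-‿cong (PS.*-congˡ E≈0)) ⟩
      a · (D̂ · κ 0ℚ) ⊕ ⊝ (b · κ 0ℚ)
        ≈⟨ solve 3 (λ a b d → a :* (d :* con (+ 0)) :+ :- (b :* con (+ 0)) := con (+ 0)) PS.refl a b D̂ ⟩
      κ 0ℚ ∎
      where
      open ≈-Reasoning
      open PS-Solver
      a = A (suc d)
      b = B (suc d)
      linear : ∀ n → evalUpTo (derived d) m n ≈ a · evalUpTo A° m n ⊕ ⊝ (b · evalUpTo A m n)
      linear zero    = solve 5 (λ a x b y q → (a :* x :+ :- (b :* y)) :* q := a :* (x :* q) :+ :- (b :* (y :* q))) PS.refl a (A° 0) b (A 0) (psPow m 0)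
      linear (suc n) = PS.trans (PS.+-congʳ (linear n))
        (solve 7 (λ a x b y q e f → (a :* e :+ :- (b :* f)) :+ (a :* x :+ :- (b :* y)) :* q := a :* (e :+ x :* q) :+ :- (b :* (f :+ y :* q)))
          PS.refl a (A° (suc n)) b (A (suc n)) (psPow m (suc n)) (evalUpTo A° m n) (evalUpTo A m n))

  module _ (m₁-m₀≢0 : m₁ - m₀ ≢ 0ℚ) where
    no-relation : ∀ d A → (∀ i → IsPoly (A i)) → (∃ λ n → A d n ≢ 0ℚ) → ¬ evalUpTo A m d ≈ κ 0ℚ
    no-relation zero A A-poly (n , An≢0) E≈0 = An≢0 (trans
      (coeff (PS.trans (PS.sym (PS.trans (PS.*-congˡ (psPow-zero m)) (PS.*-identityʳ (A 0)))) E≈0) n) (κ-zero n))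
    no-relation (suc d) A A-poly (n , An≢0) E≈0 with degree (A (suc d)) (A-poly (suc d))
    ... | inj₁ A≡0 = An≢0 (A≡0 n)
    ... | inj₂ (α , A-deg) with rationalDefect≢0 m₀ m₁ m₁-m₀≢0 d A-deg (A-poly d)
    ...   | k , defect≢0 = no-relation d (derived A d) (derived-poly A A-poly d)
              (k , λ eq → defect≢0 (trans (sym (coeff (derived-top A d) k)) eq)) (E-derived A d E≈0)

-- From evaluation of coefficient lists to sums over powers.

evalFrom : Poly₂ → PowerSeries → ℕ → PowerSeries
evalFrom []       f i n = 0ℚ
evalFrom (p ∷ ps) f i n = (polyPS p ⊛ psPow f i) n + evalFrom ps f (suc i) n

evalFrom-unique : (go : Poly₂ → PowerSeries → Poly₂ → ℕ → PowerSeries) →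
  (∀ P f i n → go P f [] i n ≡ 0ℚ) →
  (∀ P f p ps i n → go P f (p ∷ ps) i n ≡ (polyPS p ⊛ psPow f i) n + go P f ps (suc i) n) →
  ∀ P f ps i n → go P f ps i n ≡ evalFrom ps f i n
evalFrom-unique go nil cons P f []       i n = nil P f i n
evalFrom-unique go nil cons P f (p ∷ ps) i n =
  trans (cons P f p ps i n) (cong (_+_ ((polyPS p ⊛ psPow f i) n)) (evalFrom-unique go nil cons P f ps (suc i) n))

-- The worker local to evalAt cannot be named from here; the unifier solves for it once
-- its arguments have been abstracted to distinct variables.
mutual
  evalAt-worker : Poly₂ → PowerSeries → Poly₂ → ℕ → PowerSeries
  evalAt-worker = _

  evalAt-∷ : ∀ p ps f n → evalAt (p ∷ ps) f n ≡ (polyPS p ⊛ psPow f 0) n + evalFrom ps f 1 n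
  evalAt-∷ p ps f n with p ∷ ps | 1 | (polyPS p ⊛ psPow f 0) n
  ... | P | i | x = cong (_+_ x) (evalFrom-unique evalAt-worker (λ P f i n → refl) (λ P f p ps i n → refl) P f ps i n)

evalAt≡evalFrom : ∀ P f n → evalAt P f n ≡ evalFrom P f 0 n
evalAt≡evalFrom []       f n = refl
evalAt≡evalFrom (p ∷ ps) f n = evalAt-∷ p ps f n

row : Poly₂ → ℕ → Poly
row []       i       = []
row (p ∷ ps) zero    = p
row (p ∷ ps) (suc i) = row ps i

-- The sum runs one step past the last row. There `row` yields the zero polynomial, which also makes
-- the formula valid for an empty list.
evalFrom-sum : ∀ P f i n → evalFrom P f i n ≡ sumTo (λ j → (polyPS (row P j) ⊛ psPow f (i ℕ.+ j)) n) (length P)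
evalFrom-sum []       f i n = sym (trans (coeff (⊛≈· (polyPS []) (psPow f (i ℕ.+ 0))) n) ([]-· _ n))
evalFrom-sum (p ∷ ps) f i n = sym (trans (sumTo-suc _ (length ps)) (cong₂ _+_
  (cong (λ e → (polyPS p ⊛ psPow f e) n) (ℕₚ.+-identityʳ i))
  (trans (sumTo-cong (length ps) (λ j _ → cong (λ e → (polyPS (row ps j) ⊛ psPow f e) n) (ℕₚ.+-suc i j)))
         (sym (evalFrom-sum ps f (suc i) n)))))

E-sum : ∀ A f d n → evalUpTo A f d n ≡ sumTo (λ j → (A j ⊛ psPow f j) n) d
E-sum A f zero    n = sym (coeff (⊛≈· (A 0) (psPow f 0)) n)
E-sum A f (suc d) n = cong₂ _+_ (E-sum A f d n) (sym (coeff (⊛≈· (A (suc d)) (psPow f (suc d))) n))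

nonzeroPoly⇒coeff≢0 : ∀ {p} → NonzeroPoly p → ∃ λ n → polyPS p n ≢ 0ℚ
nonzeroPoly⇒coeff≢0 (here c≢0) = 0 , c≢0
nonzeroPoly⇒coeff≢0 (there nz) with nonzeroPoly⇒coeff≢0 nz
... | n , c≢0 = suc n , c≢0

nonzeroPoly₂⇒row≢0 : ∀ {P} → NonzeroPoly₂ P → ∃₂ λ i n → i ℕ.≤ length P × polyPS (row P i) n ≢ 0ℚ
nonzeroPoly₂⇒row≢0 (here nz) with nonzeroPoly⇒coeff≢0 nz
... | n , c≢0 = 0 , n , z≤n , c≢0
nonzeroPoly₂⇒row≢0 (there nz) with nonzeroPoly₂⇒row≢0 nz
... | i , n , i≤l , c≢0 = suc i , n , s≤s i≤l , c≢0

drop-leading-zero : ∀ {A f} d → (∀ n → A (suc d) n ≡ 0ℚ) → evalUpTo A f (suc d) ≈ κ 0ℚ → evalUpTo A f d ≈ κ 0ℚ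
drop-leading-zero {A} {f} d A≡0 E≈0 = coeffs λ n → trans (sym (ℚₚ.+-identityʳ _))
  (trans (cong (_+_ (evalUpTo A f d n)) (sym (trans (coeff (PS.*-comm (A (suc d)) (psPow f (suc d))) n) (·-low (psPow f (suc d)) n λ k _ → A≡0 k)))) (coeff E≈0 n))

algebraic⇒≡ : ∀ m₀ m₁ → Algebraic (seqM m₀ m₁) → m₀ ≡ m₁
algebraic⇒≡ m₀ m₁ (P , P≢0 , eval≡0) with nonzeroPoly₂⇒row≢0 P≢0
... | i , n , i≤l , c≢0 = decidable-stable (m₀ ≟ m₁) λ m₀≢m₁ →
  strip (λ eq → m₀≢m₁ (sym (ℚ-Group.x∙y⁻¹≈ε⇒x≈y m₁ m₀ eq))) (length P) i≤l
    (coeffs λ n → trans (E-sum A m (length P) n) (trans (sym (trans (evalAt≡evalFrom P m n) (evalFrom-sum P m 0 n))) (trans (eval≡0 n) (sym (κ-zero n)))))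
  where
  m = seqM m₀ m₁
  A : ℕ → PowerSeries
  A j = polyPS (row P j)
  -- Vanishing leading rows are discarded before the descent starts; the nonzero row i stops this
  -- process.
  strip : m₁ - m₀ ≢ 0ℚ → ∀ d → i ℕ.≤ d → ¬ evalUpTo A m d ≈ κ 0ℚ
  strip δ≢0 d i≤d E≈0 with degree (A d) (poly-polyPS (row P d))
  ... | inj₂ (k , Ak≢0 , _) = no-relation m₀ m₁ δ≢0 d A (λ j → poly-polyPS (row P j)) (k , Ak≢0) E≈0
  strip δ≢0 d i≤d E≈0 | inj₁ A≡0 with ℕₚ.m≤n⇒m<n∨m≡n i≤d
  ... | inj₂ refl = c≢0 (A≡0 n)
  strip δ≢0 (suc d) _ E≈0 | inj₁ A≡0 | inj₁ (s≤s i≤d) = strip δ≢0 d i≤d (drop-leading-zero d A≡0 E≈0)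

-- Motzkin numbers as differences of trinomial coefficients

-- trinomial n k is the coefficient of xᵏ in (x⁻¹ + 1 + x)ⁿ.
trinomial : ℕ → ℤ → ℤ
trinomial zero    (+ zero)  = + 1
trinomial zero    (+ suc _) = + 0
trinomial zero    -[1+ _ ]  = + 0
trinomial (suc n) k         = trinomial n (ℤ.pred k) ℤ.+ trinomial n k ℤ.+ trinomial n (ℤ.suc k)

trinomial-sym : ∀ n k → trinomial n (ℤ.- k) ≡ trinomial n k
trinomial-sym zero (+ zero)  = refl
trinomial-sym zero (+ suc _) = refl
trinomial-sym zero -[1+ _ ]  = refl
trinomial-sym (suc n) k = begin
  t (ℤ.pred (ℤ.- k)) ℤ.+ t (ℤ.- k) ℤ.+ t (ℤ.suc (ℤ.- k))
    ≡⟨ cong₂ (λ x y → t x ℤ.+ t (ℤ.- k) ℤ.+ t y)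
         (solve 1 (λ k → con -[1+ 0 ] :+ :- k := :- (con (+ 1) :+ k)) refl k)
         (solve 1 (λ k → con (+ 1) :+ :- k := :- (con -[1+ 0 ] :+ k)) refl k) ⟩
  t (ℤ.- ℤ.suc k) ℤ.+ t (ℤ.- k) ℤ.+ t (ℤ.- ℤ.pred k)
    ≡⟨ cong₂ ℤ._+_ (cong₂ ℤ._+_ (trinomial-sym n (ℤ.suc k)) (trinomial-sym n k)) (trinomial-sym n (ℤ.pred k)) ⟩
  t (ℤ.suc k) ℤ.+ t k ℤ.+ t (ℤ.pred k)
    ≡⟨ solve 3 (λ a b c → a :+ b :+ c := c :+ b :+ a) refl (t (ℤ.suc k)) (t k) (t (ℤ.pred k)) ⟩
  t (ℤ.pred k) ℤ.+ t k ℤ.+ t (ℤ.suc k) ∎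
  where
  open ≡-Reasoning
  open ℤ-Solver
  t = trinomial n

trinomial-vanishes : ∀ n j → trinomial n -[1+ n ℕ.+ j ] ≡ + 0
trinomial-vanishes zero    j = refl
trinomial-vanishes (suc n) j = cong₂ ℤ._+_ (cong₂ ℤ._+_
  (trans (cong (λ i → trinomial n -[1+ i ]) (sym (trans (ℕₚ.+-suc n (suc j)) (cong suc (ℕₚ.+-suc n j))))) (trinomial-vanishes n (2 ℕ.+ j)))
  (trans (cong (λ i → trinomial n -[1+ i ]) (sym (ℕₚ.+-suc n j))) (trinomial-vanishes n (1 ℕ.+ j))))
  (trinomial-vanishes n j)

-- Coefficients of L · (x d/dx) Lⁿ = n (x − x⁻¹) Lⁿ, where L = x⁻¹ + 1 + x.
trinomial-contiguous : ∀ n k → (+ n ℤ.+ k ℤ.+ + 1) ℤ.* trinomial n (ℤ.suc k) ℤ.+ k ℤ.* trinomial n k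
  ≡ (+ n ℤ.+ + 1 ℤ.- k) ℤ.* trinomial n (ℤ.pred k)
trinomial-contiguous zero (+ 0)           = refl
trinomial-contiguous zero (+ 1)           = refl
trinomial-contiguous zero (+ suc (suc k)) = trans (cong₂ ℤ._+_ (ℤₚ.*-zeroʳ (+ 0 ℤ.+ + suc (suc k) ℤ.+ + 1)) (ℤₚ.*-zeroʳ (+ suc (suc k)))) (sym (ℤₚ.*-zeroʳ (+ 0 ℤ.+ + 1 ℤ.- + suc (suc k))))
trinomial-contiguous zero -[1+ 0 ]        = refl
trinomial-contiguous zero -[1+ suc k ]    = trans (cong₂ ℤ._+_ (ℤₚ.*-zeroʳ (+ 0 ℤ.+ -[1+ suc k ] ℤ.+ + 1)) (ℤₚ.*-zeroʳ -[1+ suc k ])) (sym (ℤₚ.*-zeroʳ (+ 0 ℤ.+ + 1 ℤ.- -[1+ suc k ])))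
-- The instance at n + 1 is the sum of those for n at k - 1, k and k + 1. Their right-hand sides are
-- added to both sides and cancelled, so that only a polynomial identity remains for the solver.
trinomial-contiguous (suc n) k = ℤ-Group.∙-cancelʳ (R₋ ℤ.+ R₀ ℤ.+ R₊) _ _ (begin
  (+ suc n ℤ.+ k ℤ.+ + 1) ℤ.* (t (ℤ.pred (ℤ.suc k)) ℤ.+ t (ℤ.suc k) ℤ.+ t (ℤ.suc (ℤ.suc k))) ℤ.+ k ℤ.* (t (ℤ.pred k) ℤ.+ t k ℤ.+ t (ℤ.suc k)) ℤ.+ (R₋ ℤ.+ R₀ ℤ.+ R₊)
    ≡⟨ cong (λ x → (+ suc n ℤ.+ k ℤ.+ + 1) ℤ.* (t x ℤ.+ t (ℤ.suc k) ℤ.+ t (ℤ.suc (ℤ.suc k))) ℤ.+ k ℤ.* (t (ℤ.pred k) ℤ.+ t k ℤ.+ t (ℤ.suc k)) ℤ.+ (R₋ ℤ.+ R₀ ℤ.+ (+ n ℤ.+ + 1 ℤ.- ℤ.suc k) ℤ.* t x)) (ℤₚ.pred-suc k) ⟩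
  (+ suc n ℤ.+ k ℤ.+ + 1) ℤ.* (t k ℤ.+ t (ℤ.suc k) ℤ.+ t (ℤ.suc (ℤ.suc k))) ℤ.+ k ℤ.* (t (ℤ.pred k) ℤ.+ t k ℤ.+ t (ℤ.suc k)) ℤ.+ (R₋ ℤ.+ R₀ ℤ.+ (+ n ℤ.+ + 1 ℤ.- ℤ.suc k) ℤ.* t k)
    ≡⟨ solve 7 (λ n k a b c d e →
         (con (+ 1) :+ n :+ k :+ con (+ 1)) :* (c :+ d :+ e) :+ k :* (b :+ c :+ d)
           :+ ((n :+ con (+ 1) :- (con -[1+ 0 ] :+ k)) :* a :+ (n :+ con (+ 1) :- k) :* b :+ (n :+ con (+ 1) :- (con (+ 1) :+ k)) :* c)
         := (con (+ 1) :+ n :+ con (+ 1) :- k) :* (a :+ b :+ c)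
           :+ (((n :+ (con -[1+ 0 ] :+ k) :+ con (+ 1)) :* c :+ (con -[1+ 0 ] :+ k) :* b) :+ ((n :+ k :+ con (+ 1)) :* d :+ k :* c)
               :+ ((n :+ (con (+ 1) :+ k) :+ con (+ 1)) :* e :+ (con (+ 1) :+ k) :* d)))
         refl (+ n) k (t (ℤ.pred (ℤ.pred k))) (t (ℤ.pred k)) (t k) (t (ℤ.suc k)) (t (ℤ.suc (ℤ.suc k))) ⟩
  (+ suc n ℤ.+ + 1 ℤ.- k) ℤ.* (t (ℤ.pred (ℤ.pred k)) ℤ.+ t (ℤ.pred k) ℤ.+ t k)
    ℤ.+ (((+ n ℤ.+ ℤ.pred k ℤ.+ + 1) ℤ.* t k ℤ.+ ℤ.pred k ℤ.* t (ℤ.pred k)) ℤ.+ ((+ n ℤ.+ k ℤ.+ + 1) ℤ.* t (ℤ.suc k) ℤ.+ k ℤ.* t k)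
         ℤ.+ ((+ n ℤ.+ ℤ.suc k ℤ.+ + 1) ℤ.* t (ℤ.suc (ℤ.suc k)) ℤ.+ ℤ.suc k ℤ.* t (ℤ.suc k)))
    ≡⟨ cong (λ x → (+ suc n ℤ.+ + 1 ℤ.- k) ℤ.* (t (ℤ.pred (ℤ.pred k)) ℤ.+ t (ℤ.pred k) ℤ.+ t x)
         ℤ.+ (((+ n ℤ.+ ℤ.pred k ℤ.+ + 1) ℤ.* t x ℤ.+ ℤ.pred k ℤ.* t (ℤ.pred k)) ℤ.+ ((+ n ℤ.+ k ℤ.+ + 1) ℤ.* t (ℤ.suc k) ℤ.+ k ℤ.* t k)
         ℤ.+ ((+ n ℤ.+ ℤ.suc k ℤ.+ + 1) ℤ.* t (ℤ.suc (ℤ.suc k)) ℤ.+ ℤ.suc k ℤ.* t (ℤ.suc k)))) (ℤₚ.suc-pred k) ⟨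
  (+ suc n ℤ.+ + 1 ℤ.- k) ℤ.* (t (ℤ.pred (ℤ.pred k)) ℤ.+ t (ℤ.pred k) ℤ.+ t (ℤ.suc (ℤ.pred k)))
    ℤ.+ (((+ n ℤ.+ ℤ.pred k ℤ.+ + 1) ℤ.* t (ℤ.suc (ℤ.pred k)) ℤ.+ ℤ.pred k ℤ.* t (ℤ.pred k)) ℤ.+ ((+ n ℤ.+ k ℤ.+ + 1) ℤ.* t (ℤ.suc k) ℤ.+ k ℤ.* t k)
         ℤ.+ ((+ n ℤ.+ ℤ.suc k ℤ.+ + 1) ℤ.* t (ℤ.suc (ℤ.suc k)) ℤ.+ ℤ.suc k ℤ.* t (ℤ.suc k)))
    ≡⟨ cong (ℤ._+_ ((+ suc n ℤ.+ + 1 ℤ.- k) ℤ.* (t (ℤ.pred (ℤ.pred k)) ℤ.+ t (ℤ.pred k) ℤ.+ t (ℤ.suc (ℤ.pred k)))))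
         (cong₂ ℤ._+_ (cong₂ ℤ._+_ (trinomial-contiguous n (ℤ.pred k)) (trinomial-contiguous n k)) (trinomial-contiguous n (ℤ.suc k))) ⟩
  (+ suc n ℤ.+ + 1 ℤ.- k) ℤ.* (t (ℤ.pred (ℤ.pred k)) ℤ.+ t (ℤ.pred k) ℤ.+ t (ℤ.suc (ℤ.pred k))) ℤ.+ (R₋ ℤ.+ R₀ ℤ.+ R₊) ∎)
  where
  open ≡-Reasoning
  open ℤ-Solver
  t = trinomial n
  R₋ = (+ n ℤ.+ + 1 ℤ.- ℤ.pred k) ℤ.* t (ℤ.pred (ℤ.pred k))
  R₀ = (+ n ℤ.+ + 1 ℤ.- k) ℤ.* t (ℤ.pred k)
  R₊ = (+ n ℤ.+ + 1 ℤ.- ℤ.suc k) ℤ.* t (ℤ.pred (ℤ.suc k))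

motzkin : ℕ → ℤ
motzkin n = trinomial n (+ 0) ℤ.- trinomial n (+ 2)

-- With e, f, g the coefficients at 0, 1, 2, contiguity at k = 1 reads (n+2) g + f = n e. Its
-- instances at n + 2, n + 1 and n, combined with the weights -1, 2, 3 (the coefficients of -D),
-- give the recurrence once e at n + 1 is replaced by e + 2 f at n.
motzkin-recurrence : ∀ n → (+ 4 ℤ.+ + n) ℤ.* motzkin (2 ℕ.+ n)
  ≡ (+ 5 ℤ.+ + 2 ℤ.* + n) ℤ.* motzkin (1 ℕ.+ n) ℤ.+ (+ 3 ℤ.+ + 3 ℤ.* + n) ℤ.* motzkin n
motzkin-recurrence n = ℤ-Group.∙-cancelʳ (L₂ ℤ.+ + 2 ℤ.* R₁ ℤ.+ + 3 ℤ.* R₀) _ _ (begin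
  (+ 4 ℤ.+ + n) ℤ.* (e₂ ℤ.- g₂) ℤ.+ (L₂ ℤ.+ + 2 ℤ.* R₁ ℤ.+ + 3 ℤ.* R₀)
    ≡⟨ solve 9 (λ n e₂ g₂ e₁ f₁ g₁ e f g →
         (con (+ 4) :+ n) :* (e₂ :- g₂)
           :+ (((con (+ 2) :+ n :+ con (+ 2)) :* g₂ :+ (e₁ :+ f₁ :+ g₁)) :+ con (+ 2) :* ((con (+ 1) :+ n) :* e₁) :+ con (+ 3) :* (n :* e))
         := con (+ 2) :* e₂ :+ (con (+ 3) :+ con (+ 2) :* n) :* e₁ :+ f₁ :+ g₁ :+ con (+ 3) :* (n :* e) :+ (con (+ 2) :+ n) :* e₂)
         refl (+ n) e₂ g₂ e₁ f₁ g₁ e₀ f₀ g₀ ⟩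
  + 2 ℤ.* e₂ ℤ.+ (+ 3 ℤ.+ + 2 ℤ.* + n) ℤ.* e₁ ℤ.+ f₁ ℤ.+ g₁ ℤ.+ + 3 ℤ.* (+ n ℤ.* e₀) ℤ.+ R₂
    ≡⟨ cong₂ (λ x y → + 2 ℤ.* x ℤ.+ (+ 3 ℤ.+ + 2 ℤ.* + n) ℤ.* y ℤ.+ f₁ ℤ.+ g₁ ℤ.+ + 3 ℤ.* (+ n ℤ.* e₀) ℤ.+ R₂) (trans (e-suc (suc n)) (cong (ℤ._+ + 2 ℤ.* f₁) (e-suc n))) (e-suc n) ⟩
  + 2 ℤ.* (e₁′ ℤ.+ + 2 ℤ.* f₁) ℤ.+ (+ 3 ℤ.+ + 2 ℤ.* + n) ℤ.* e₁′ ℤ.+ f₁ ℤ.+ g₁ ℤ.+ + 3 ℤ.* (+ n ℤ.* e₀) ℤ.+ R₂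
    ≡⟨ solve 6 (λ n e f g g₁ r₂ →
         let e₁ = e :+ con (+ 2) :* f
             f₁ = e :+ f :+ g
         in con (+ 2) :* (e₁ :+ con (+ 2) :* f₁) :+ (con (+ 3) :+ con (+ 2) :* n) :* e₁ :+ f₁ :+ g₁ :+ con (+ 3) :* (n :* e) :+ r₂
            := (con (+ 5) :+ con (+ 2) :* n) :* (e₁ :- g₁) :+ (con (+ 3) :+ con (+ 3) :* n) :* (e :- g)
              :+ (r₂ :+ con (+ 2) :* ((con (+ 1) :+ n :+ con (+ 2)) :* g₁ :+ f₁) :+ con (+ 3) :* ((n :+ con (+ 2)) :* g :+ f)))
         refl (+ n) e₀ f₀ g₀ g₁ R₂ ⟩
  (+ 5 ℤ.+ + 2 ℤ.* + n) ℤ.* (e₁′ ℤ.- g₁) ℤ.+ (+ 3 ℤ.+ + 3 ℤ.* + n) ℤ.* (e₀ ℤ.- g₀) ℤ.+ (R₂ ℤ.+ + 2 ℤ.* L₁ ℤ.+ + 3 ℤ.* L₀)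
    ≡⟨ cong (λ x → (+ 5 ℤ.+ + 2 ℤ.* + n) ℤ.* (x ℤ.- g₁) ℤ.+ (+ 3 ℤ.+ + 3 ℤ.* + n) ℤ.* (e₀ ℤ.- g₀) ℤ.+ (R₂ ℤ.+ + 2 ℤ.* L₁ ℤ.+ + 3 ℤ.* L₀)) (e-suc n) ⟨
  (+ 5 ℤ.+ + 2 ℤ.* + n) ℤ.* (e₁ ℤ.- g₁) ℤ.+ (+ 3 ℤ.+ + 3 ℤ.* + n) ℤ.* (e₀ ℤ.- g₀) ℤ.+ (R₂ ℤ.+ + 2 ℤ.* L₁ ℤ.+ + 3 ℤ.* L₀)
    ≡⟨ cong (ℤ._+_ ((+ 5 ℤ.+ + 2 ℤ.* + n) ℤ.* (e₁ ℤ.- g₁) ℤ.+ (+ 3 ℤ.+ + 3 ℤ.* + n) ℤ.* (e₀ ℤ.- g₀)))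
         (cong₂ ℤ._+_ (cong₂ (λ x y → x ℤ.+ + 2 ℤ.* y) (sym (contiguous (2 ℕ.+ n))) (contiguous (1 ℕ.+ n))) (cong (ℤ._*_ (+ 3)) (contiguous n))) ⟩
  (+ 5 ℤ.+ + 2 ℤ.* + n) ℤ.* (e₁ ℤ.- g₁) ℤ.+ (+ 3 ℤ.+ + 3 ℤ.* + n) ℤ.* (e₀ ℤ.- g₀) ℤ.+ (L₂ ℤ.+ + 2 ℤ.* R₁ ℤ.+ + 3 ℤ.* R₀) ∎)
  where
  open ≡-Reasoning
  open ℤ-Solver
  e f g L R : ℕ → ℤ
  e n = trinomial n (+ 0)
  f n = trinomial n (+ 1)
  g n = trinomial n (+ 2)
  L n = (+ n ℤ.+ + 2) ℤ.* g n ℤ.+ f n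
  R n = + n ℤ.* e n
  e-suc : ∀ n → e (suc n) ≡ e n ℤ.+ + 2 ℤ.* f n
  e-suc n = trans (cong (λ x → x ℤ.+ e n ℤ.+ f n) (trinomial-sym n (+ 1))) (solve 2 (λ e f → f :+ e :+ f := e :+ con (+ 2) :* f) refl (e n) (f n))
  contiguous : ∀ n → L n ≡ R n
  contiguous n = trans (solve 3 (λ n f g → (n :+ con (+ 2)) :* g :+ f := (n :+ con (+ 1) :+ con (+ 1)) :* g :+ con (+ 1) :* f) refl (+ n) (f n) (g n))
    (trans (trinomial-contiguous n (+ 1)) (solve 2 (λ n e → (n :+ con (+ 1) :- con (+ 1)) :* e := n :* e) refl (+ n) (e n)))
  e₀ = e n
  e₁ = e (1 ℕ.+ n)
  e₂ = e (2 ℕ.+ n)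
  f₀ = f n
  f₁ = f (1 ℕ.+ n)
  g₀ = g n
  g₁ = g (1 ℕ.+ n)
  g₂ = g (2 ℕ.+ n)
  e₁′ = e₀ ℤ.+ + 2 ℤ.* f₀
  L₀ = L n
  L₁ = L (1 ℕ.+ n)
  L₂ = L (2 ℕ.+ n)
  R₀ = R n
  R₁ = R (1 ℕ.+ n)
  R₂ = R (2 ℕ.+ n)

module _ (c : ℚ) where
  private
    a : ℕ → ℚ
    a n = c * ιℤ (motzkin n)

    a-recurrence : Recurrence a
    a-recurrence k = begin
      (ιℕ 4 + ιℕ k) * (c * ι₂)
        ≡⟨ solve 3 (λ x c y → (con (+ 4) :+ x) :* (c :* y) := c :* ((con (+ 4) :+ x) :* y)) refl (ιℕ k) c ι₂ ⟩
      c * ((ιℕ 4 + ιℕ k) * ι₂)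
        ≡⟨ cong (_*_ c) (begin
             (ιℕ 4 + ιℕ k) * ι₂
               ≡⟨ cong (_* ι₂) (ιℤ-homo-+ (+ 4) (+ k)) ⟨
             ιℤ (+ 4 ℤ.+ + k) * ι₂
               ≡⟨ ιℤ-homo-* (+ 4 ℤ.+ + k) (motzkin (2 ℕ.+ k)) ⟨
             ιℤ ((+ 4 ℤ.+ + k) ℤ.* motzkin (2 ℕ.+ k))
               ≡⟨ cong ιℤ (motzkin-recurrence k) ⟩
             ιℤ ((+ 5 ℤ.+ + 2 ℤ.* + k) ℤ.* motzkin (1 ℕ.+ k) ℤ.+ (+ 3 ℤ.+ + 3 ℤ.* + k) ℤ.* motzkin k)
               ≡⟨ trans (ιℤ-homo-+ (x ℤ.* motzkin (1 ℕ.+ k)) (y ℤ.* motzkin k)) (cong₂ _+_ (ιℤ-homo-* x (motzkin (1 ℕ.+ k))) (ιℤ-homo-* y (motzkin k))) ⟩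
             ιℤ (+ 5 ℤ.+ + 2 ℤ.* + k) * ι₁ + ιℤ (+ 3 ℤ.+ + 3 ℤ.* + k) * ι₀
               ≡⟨ cong₂ (λ x y → x * ι₁ + y * ι₀) (lin 5 2) (lin 3 3) ⟩
             (ιℕ 5 + ιℕ 2 * ιℕ k) * ι₁ + (ιℕ 3 + ιℕ 3 * ιℕ k) * ι₀ ∎) ⟩
      c * ((ιℕ 5 + ιℕ 2 * ιℕ k) * ι₁ + (ιℕ 3 + ιℕ 3 * ιℕ k) * ι₀)
        ≡⟨ solve 5 (λ x y c a b → c :* (x :* a :+ y :* b) := x :* (c :* a) :+ y :* (c :* b)) refl (ιℕ 5 + ιℕ 2 * ιℕ k) (ιℕ 3 + ιℕ 3 * ιℕ k) c ι₁ ι₀ ⟩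
      (ιℕ 5 + ιℕ 2 * ιℕ k) * (c * ι₁) + (ιℕ 3 + ιℕ 3 * ιℕ k) * (c * ι₀) ∎
      where
      open ≡-Reasoning
      open ℚ-Solver
      x = + 5 ℤ.+ + 2 ℤ.* + k
      y = + 3 ℤ.+ + 3 ℤ.* + k
      ι₀ = ιℤ (motzkin k)
      ι₁ = ιℤ (motzkin (1 ℕ.+ k))
      ι₂ = ιℤ (motzkin (2 ℕ.+ k))
      lin : ∀ x y → ιℤ (+ x ℤ.+ + y ℤ.* + k) ≡ ιℕ x + ιℕ y * ιℕ k
      lin x y = trans (ιℤ-homo-+ (+ x) (+ y ℤ.* + k)) (cong (_+_ (ιℕ x)) (ιℤ-homo-* (+ y) (+ k)))

  seqM≡motzkin : ∀ n → seqM c c n ≡ c * ιℤ (motzkin n)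
  seqM≡motzkin = recurrence-unique {g = a} (seqM-recurrence c c) a-recurrence (sym (ℚₚ.*-identityʳ c)) (sym (ℚₚ.*-identityʳ c))

  seqM-bounded-denominator : Σ ℤ λ b → b ≢ + 0 × (∀ n → IsInteger (ιℤ b * seqM c c n))
  seqM-bounded-denominator = ↧ c , (λ ()) , λ n → subst IsInteger
    (sym (trans (cong (_*_ (ιℤ (↧ c))) (seqM≡motzkin n)) (trans (sym (ℚₚ.*-assoc (ιℤ (↧ c)) c _)) (cong (_* ιℤ (motzkin n)) (clear-denominator c)))))
    (*-integer (ιℤ-integer (↥ c)) (ιℤ-integer (motzkin n)))

-- Exponential growth bound.

∣trinomial∣≤3ⁿ : ∀ n k → ∣ ιℤ (trinomial n k) ∣ ≤ pow (ιℕ 3) n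
∣trinomial∣≤3ⁿ zero (+ zero)  = ℚₚ.≤-refl
∣trinomial∣≤3ⁿ zero (+ suc _) = ℚₚ.nonNegative⁻¹ 1ℚ
∣trinomial∣≤3ⁿ zero -[1+ _ ]  = ℚₚ.nonNegative⁻¹ 1ℚ
∣trinomial∣≤3ⁿ (suc n) k = begin
  ∣ ιℤ (x ℤ.+ y ℤ.+ z) ∣                    ≡⟨ cong ∣_∣ (trans (ιℤ-homo-+ (x ℤ.+ y) z) (cong (_+ ιℤ z) (ιℤ-homo-+ x y))) ⟩
  ∣ ιℤ x + ιℤ y + ιℤ z ∣                    ≤⟨ ℚₚ.∣p+q∣≤∣p∣+∣q∣ (ιℤ x + ιℤ y) (ιℤ z) ⟩
  ∣ ιℤ x + ιℤ y ∣ + ∣ ιℤ z ∣                ≤⟨ ℚₚ.+-monoˡ-≤ ∣ ιℤ z ∣ (ℚₚ.∣p+q∣≤∣p∣+∣q∣ (ιℤ x) (ιℤ y)) ⟩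
  ∣ ιℤ x ∣ + ∣ ιℤ y ∣ + ∣ ιℤ z ∣            ≤⟨ ℚₚ.+-mono-≤ (ℚₚ.+-mono-≤ (∣trinomial∣≤3ⁿ n (ℤ.pred k)) (∣trinomial∣≤3ⁿ n k)) (∣trinomial∣≤3ⁿ n (ℤ.suc k)) ⟩
  pow (ιℕ 3) n + pow (ιℕ 3) n + pow (ιℕ 3) n ≡⟨ solve 1 (λ p → p :+ p :+ p := con (+ 3) :* p) refl (pow (ιℕ 3) n) ⟩
  ιℕ 3 * pow (ιℕ 3) n                       ∎
  where
  open ℚₚ.≤-Reasoning
  open ℚ-Solver
  x = trinomial n (ℤ.pred k)
  y = trinomial n k
  z = trinomial n (ℤ.suc k)

seqM-positiveRadius : ∀ c → PositiveRadius (seqM c c)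
seqM-positiveRadius c = ∣ c ∣ * ιℕ 2 , ιℕ 3 , λ n → begin
  ∣ seqM c c n ∣                                   ≡⟨ cong ∣_∣ (seqM≡motzkin c n) ⟩
  ∣ c * ιℤ (motzkin n) ∣                           ≡⟨ ℚₚ.∣p*q∣≡∣p∣*∣q∣ c (ιℤ (motzkin n)) ⟩
  ∣ c ∣ * ∣ ιℤ (motzkin n) ∣                       ≤⟨ ℚₚ.*-monoˡ-≤-nonNeg ∣ c ∣ {{nonNegative (ℚₚ.0≤∣p∣ c)}} (bound n) ⟩
  ∣ c ∣ * (ιℕ 2 * pow (ιℕ 3) n)                    ≡⟨ ℚₚ.*-assoc ∣ c ∣ (ιℕ 2) _ ⟨
  ∣ c ∣ * ιℕ 2 * pow (ιℕ 3) n                      ∎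
  where
  open ℚₚ.≤-Reasoning
  bound : ∀ n → ∣ ιℤ (motzkin n) ∣ ≤ ιℕ 2 * pow (ιℕ 3) n
  bound n = begin
    ∣ ιℤ (x ℤ.- y) ∣               ≡⟨ cong ∣_∣ (trans (ιℤ-homo-+ x (ℤ.- y)) (cong (_+_ (ιℤ x)) (ιℤ-homo‿- y))) ⟩
    ∣ ιℤ x - ιℤ y ∣                ≤⟨ ℚₚ.∣p-q∣≤∣p∣+∣q∣ (ιℤ x) (ιℤ y) ⟩
    ∣ ιℤ x ∣ + ∣ ιℤ y ∣            ≤⟨ ℚₚ.+-mono-≤ (∣trinomial∣≤3ⁿ n (+ 0)) (∣trinomial∣≤3ⁿ n (+ 2)) ⟩
    pow (ιℕ 3) n + pow (ιℕ 3) n    ≡⟨ solve 1 (λ p → p :+ p := con (+ 2) :* p) refl (pow (ιℕ 3) n) ⟩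
    ιℕ 2 * pow (ιℕ 3) n            ∎
    where
    open ℚ-Solver
    x = trinomial n (+ 0)
    y = trinomial n (+ 2)

-- The Motzkin series as a diagonal

-- ballotCentred i k is the coefficient of xᵏ in (1 − x²) (x⁻¹ + 1 + x)ⁱ, and ballot i j
-- the coefficient of x₁ⁱ x₂ʲ in (1 − x₂²) / (1 − x₁ (1 + x₂ + x₂²)).
ballotCentred : ℕ → ℤ → ℤ
ballotCentred i k = trinomial i k ℤ.- trinomial i (ℤ.pred (ℤ.pred k))

ballot : ℕ → ℕ → ℤ
ballot i j = ballotCentred i (+ j ℤ.- + i)

ballotCentred-vanishes : ∀ i j → ballotCentred i -[1+ i ℕ.+ j ] ≡ + 0
ballotCentred-vanishes i j = cong₂ ℤ._-_ (trinomial-vanishes i j)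
  (trans (cong (λ l → trinomial i -[1+ l ]) (sym (trans (ℕₚ.+-suc i (suc j)) (cong suc (ℕₚ.+-suc i j))))) (trinomial-vanishes i (2 ℕ.+ j)))

-- Stated at `pred k` because raising i by one lowers the centred index j - i by one.
ballotCentred-suc : ∀ i k → ballotCentred (suc i) (ℤ.pred k) ≡ ballotCentred i (ℤ.pred (ℤ.pred k)) ℤ.+ ballotCentred i (ℤ.pred k) ℤ.+ ballotCentred i k
ballotCentred-suc i k = trans
  (cong₂ (λ x y → (t (p² k) ℤ.+ t (ℤ.pred k) ℤ.+ t x) ℤ.- (t (p² (p² k)) ℤ.+ t (ℤ.pred (p² k)) ℤ.+ t y)) (ℤₚ.suc-pred k) (ℤₚ.suc-pred (p² k)))
  (solve 5 (λ a b c d e → (c :+ b :+ a) :- (e :+ d :+ c) := (c :- e) :+ (b :- d) :+ (a :- c)) refl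
    (t k) (t (ℤ.pred k)) (t (p² k)) (t (ℤ.pred (p² k))) (t (p² (p² k))))
  where
  open ℤ-Solver
  t = trinomial i
  p² : ℤ → ℤ
  p² k = ℤ.pred (ℤ.pred k)

private
  shift : ∀ i j → + j ℤ.- + suc i ≡ ℤ.pred (+ j ℤ.- + i)
  shift i j = solve 2 (λ i j → j :- (con (+ 1) :+ i) := con -[1+ 0 ] :+ (j :- i)) refl (+ i) (+ j)
    where open ℤ-Solver

  shift′ : ∀ i j → ℤ.pred (+ suc j ℤ.- + i) ≡ + j ℤ.- + i
  shift′ i j = solve 2 (λ i j → con -[1+ 0 ] :+ ((con (+ 1) :+ j) :- i) := j :- i) refl (+ i) (+ j)
    where open ℤ-Solver

  negative : ∀ i → ℤ.pred (+ 0 ℤ.- + i) ≡ -[1+ i ℕ.+ 0 ]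
  negative zero    = refl
  negative (suc i) = cong -[1+_] (cong suc (sym (ℕₚ.+-identityʳ i)))

  negative′ : ∀ i → ℤ.pred (ℤ.pred (+ 0 ℤ.- + i)) ≡ -[1+ i ℕ.+ 1 ]
  negative′ zero    = refl
  negative′ (suc i) = cong -[1+_] (cong suc (ℕₚ.+-comm 1 i))

-- Multiplication by 1 + x₂ + x₂² adds the entries at j - 2, j - 1 and j; for j = 0 and j = 1 some
-- of these lie below x⁻ⁱ in the centred picture and vanish. Hence three separate cases for j.
ballot-0 : ∀ i → ballot (suc i) 0 ≡ ballot i 0
ballot-0 i = begin
  ballotCentred (suc i) (+ 0 ℤ.- + suc i)   ≡⟨ cong (ballotCentred (suc i)) (shift i 0) ⟩
  ballotCentred (suc i) (ℤ.pred k)          ≡⟨ ballotCentred-suc i k ⟩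
  ballotCentred i (ℤ.pred (ℤ.pred k)) ℤ.+ ballotCentred i (ℤ.pred k) ℤ.+ ballotCentred i k
    ≡⟨ cong₂ (λ x y → ballotCentred i x ℤ.+ ballotCentred i y ℤ.+ ballotCentred i k) (negative′ i) (negative i) ⟩
  ballotCentred i -[1+ i ℕ.+ 1 ] ℤ.+ ballotCentred i -[1+ i ℕ.+ 0 ] ℤ.+ ballotCentred i k
    ≡⟨ cong₂ (λ x y → x ℤ.+ y ℤ.+ ballotCentred i k) (ballotCentred-vanishes i 1) (ballotCentred-vanishes i 0) ⟩
  + 0 ℤ.+ ballotCentred i k                 ≡⟨ ℤₚ.+-identityˡ _ ⟩
  ballotCentred i k                         ∎
  where
  open ≡-Reasoning
  k = + 0 ℤ.- + i

ballot-1 : ∀ i → ballot (suc i) 1 ≡ ballot i 0 ℤ.+ ballot i 1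
ballot-1 i = begin
  ballotCentred (suc i) (+ 1 ℤ.- + suc i)   ≡⟨ cong (ballotCentred (suc i)) (shift i 1) ⟩
  ballotCentred (suc i) (ℤ.pred k)          ≡⟨ ballotCentred-suc i k ⟩
  ballotCentred i (ℤ.pred (ℤ.pred k)) ℤ.+ ballotCentred i (ℤ.pred k) ℤ.+ ballotCentred i k
    ≡⟨ cong₂ (λ x y → ballotCentred i x ℤ.+ ballotCentred i y ℤ.+ ballotCentred i k) (trans (cong ℤ.pred (shift′ i 0)) (negative i)) (shift′ i 0) ⟩
  ballotCentred i -[1+ i ℕ.+ 0 ] ℤ.+ ballot i 0 ℤ.+ ballot i 1
    ≡⟨ cong (λ x → x ℤ.+ ballot i 0 ℤ.+ ballot i 1) (ballotCentred-vanishes i 0) ⟩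
  + 0 ℤ.+ ballot i 0 ℤ.+ ballot i 1         ≡⟨ cong (ℤ._+ ballot i 1) (ℤₚ.+-identityˡ (ballot i 0)) ⟩
  ballot i 0 ℤ.+ ballot i 1                 ∎
  where
  open ≡-Reasoning
  k = + 1 ℤ.- + i

ballot-suc : ∀ i j → ballot (suc i) (2 ℕ.+ j) ≡ ballot i j ℤ.+ ballot i (1 ℕ.+ j) ℤ.+ ballot i (2 ℕ.+ j)
ballot-suc i j = begin
  ballotCentred (suc i) (+ (2 ℕ.+ j) ℤ.- + suc i)   ≡⟨ cong (ballotCentred (suc i)) (shift i (2 ℕ.+ j)) ⟩
  ballotCentred (suc i) (ℤ.pred k)                  ≡⟨ ballotCentred-suc i k ⟩
  ballotCentred i (ℤ.pred (ℤ.pred k)) ℤ.+ ballotCentred i (ℤ.pred k) ℤ.+ ballotCentred i k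
    ≡⟨ cong₂ (λ x y → ballotCentred i x ℤ.+ ballotCentred i y ℤ.+ ballotCentred i k) (trans (cong ℤ.pred (shift′ i (suc j))) (shift′ i j)) (shift′ i (suc j)) ⟩
  ballot i j ℤ.+ ballot i (1 ℕ.+ j) ℤ.+ ballot i (2 ℕ.+ j) ∎
  where
  open ≡-Reasoning
  k = + (2 ℕ.+ j) ℤ.- + i

ballot-diagonal : ∀ n → ballot n n ≡ motzkin n
ballot-diagonal n = trans (cong (ballotCentred n) (ℤₚ.+-inverseʳ (+ n))) (cong (ℤ._-_ (trinomial n (+ 0))) (trinomial-sym n (+ 2)))

sumTo-single : ∀ {f} n → (∀ k → f (suc k) ≡ 0ℚ) → sumTo f n ≡ f 0
sumTo-single         zero    f≡0 = refl
sumTo-single {f} (suc n) f≡0 = trans (sumTo-suc f n) (trans (cong (_+_ (f 0)) (sumTo-zero n λ k _ → f≡0 k)) (ℚₚ.+-identityʳ (f 0)))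

module _ (c : ℚ) where
  private
    Q P : Poly₂
    Q = (1ℚ ∷ []) ∷ (- 1ℚ ∷ - 1ℚ ∷ - 1ℚ ∷ []) ∷ []
    P = (c ∷ 0ℚ ∷ - c ∷ []) ∷ []

    R : PowerSeries₂
    R i j = c * ιℤ (ballot i j)

    Q₀ Q₁ : Poly
    Q₀ = 1ℚ ∷ []
    Q₁ = - 1ℚ ∷ - 1ℚ ∷ - 1ℚ ∷ []

    []-⊛ : ∀ f n → (polyPS [] ⊛ f) n ≡ 0ℚ
    []-⊛ f n = trans (coeff (⊛≈· (polyPS []) f) n) ([]-· f n)

    Q₀-⊛ : ∀ f n → (polyPS Q₀ ⊛ f) n ≡ f n
    Q₀-⊛ f n = trans (coeff (⊛≈· (polyPS Q₀) f) n) (trans ([c]-· 1ℚ f n) (ℚₚ.*-identityˡ (f n)))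

    R₀ : ∀ j → R 0 j ≡ poly₂PS P 0 j
    R₀ zero                = ℚₚ.*-identityʳ c
    R₀ (suc zero)          = ℚₚ.*-zeroʳ c
    R₀ (suc (suc zero))    = solve 1 (λ c → c :* con -[1+ 0 ] := :- c) refl c
      where open ℚ-Solver
    R₀ (suc (suc (suc j))) = ℚₚ.*-zeroʳ c

    R-suc : ∀ i j → R (suc i) j + (polyPS Q₁ ⊛ R i) j ≡ 0ℚ
    R-suc i zero = trans (cong (λ x → c * ιℤ x + - 1ℚ * R i 0) (ballot-0 i))
      (solve 1 (λ x → x :+ con -[1+ 0 ] :* x := con (+ 0)) refl (R i 0))
      where open ℚ-Solver
    R-suc i (suc zero) = trans (cong₂ _+_
        (cong (_*_ c) (trans (cong ιℤ (ballot-1 i)) (ιℤ-homo-+ (ballot i 0) (ballot i 1))))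
        (trans (coeff (⊛≈· (polyPS Q₁) (R i)) 1) (linear-· (- 1ℚ) (- 1ℚ) (- 1ℚ ∷ []) (R i))))
      (solve 3 (λ c x y → c :* (x :+ y) :+ (con -[1+ 0 ] :* (c :* y) :+ con -[1+ 0 ] :* (c :* x)) := con (+ 0)) refl c (ιℤ (ballot i 0)) (ιℤ (ballot i 1)))
      where open ℚ-Solver
    R-suc i (suc (suc j)) = trans (cong₂ _+_
        (cong (_*_ c) (trans (cong ιℤ (ballot-suc i j)) (trans (ιℤ-homo-+ (ballot i j ℤ.+ ballot i (1 ℕ.+ j)) _)
          (cong (_+ ιℤ (ballot i (2 ℕ.+ j))) (ιℤ-homo-+ (ballot i j) (ballot i (1 ℕ.+ j)))))))
        (trans (coeff (⊛≈· (polyPS Q₁) (R i)) (2 ℕ.+ j)) (quadratic-· (- 1ℚ) (- 1ℚ) (- 1ℚ) (R i) j)))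
      (solve 4 (λ c x y z → c :* (x :+ y :+ z) :+ (con -[1+ 0 ] :* (c :* z) :+ (con -[1+ 0 ] :* (c :* y) :+ con -[1+ 0 ] :* (c :* x))) := con (+ 0))
        refl c (ιℤ (ballot i j)) (ιℤ (ballot i (1 ℕ.+ j))) (ιℤ (ballot i (2 ℕ.+ j))))
      where open ℚ-Solver

    QR≡P : ∀ i j → (poly₂PS Q ⊛₂ R) i j ≡ poly₂PS P i j
    QR≡P zero    j = trans (Q₀-⊛ (R 0) j) (R₀ j)
    QR≡P (suc i) j = trans (sumTo-suc (λ a → (poly₂PS Q a ⊛ R (suc i ∸ a)) j) i) (trans
      (cong₂ _+_ (Q₀-⊛ (R (suc i)) j) (sumTo-single {λ a → (poly₂PS Q (suc a) ⊛ R (i ∸ a)) j} i λ k → []-⊛ (R (i ∸ suc k)) j))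
      (R-suc i j))

  seqM-diagonal : DiagonalOfRational₂ (seqM c c)
  seqM-diagonal = P , Q , R , here (here 1≢0) , QR≡P ,
    λ n → trans (cong (λ z → c * ιℤ z) (ballot-diagonal n)) (sym (seqM≡motzkin c n))

-- Diagonals of rational functions are almost integral

0-integer : IsInteger 0ℚ
0-integer = ιℤ-integer (+ 0)

sumTo-integer : ∀ f n → (∀ k → k ℕ.≤ n → IsInteger (f k)) → IsInteger (sumTo f n)
sumTo-integer f zero    int = int 0 z≤n
sumTo-integer f (suc n) int = +-integer (sumTo-integer f n λ k k≤n → int k (ℕₚ.m≤n⇒m≤1+n k≤n)) (int (suc n) ℕₚ.≤-refl)

sumTo-isolate : ∀ f n i → i ℕ.≤ n → IsInteger (sumTo f n) → (∀ k → k ℕ.≤ n → k ≢ i → IsInteger (f k)) → IsInteger (f i)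
sumTo-isolate f zero    zero _ total rest = total
sumTo-isolate f (suc n) i i≤n total rest with ℕₚ.m≤n⇒m<n∨m≡n i≤n
... | inj₂ refl = subst IsInteger (solve 2 (λ s x → (s :+ x) :+ :- s := x) refl (sumTo f n) (f (suc n)))
  (+-integer total (neg-integer (sumTo-integer f n λ k k≤n → rest k (ℕₚ.m≤n⇒m≤1+n k≤n) (ℕₚ.<⇒≢ (s≤s k≤n)))))
  where open ℚ-Solver
... | inj₁ (s≤s i≤n′) = sumTo-isolate f n i i≤n′
  (subst IsInteger (solve 2 (λ s x → (s :+ x) :+ :- x := s) refl (sumTo f n) (f (suc n)))
    (+-integer total (neg-integer (rest (suc n) ℕₚ.≤-refl (λ eq → ℕₚ.<⇒≢ (s≤s i≤n′) (sym eq))))))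
  (λ k k≤n → rest k (ℕₚ.m≤n⇒m≤1+n k≤n))
  where open ℚ-Solver

ℤ-*-≢0 : ∀ {a b} → a ≢ + 0 → b ≢ + 0 → a ℤ.* b ≢ + 0
ℤ-*-≢0 {a} {b} a≢0 b≢0 eq = *-≢0 (ιℤ-≢0 a≢0) (ιℤ-≢0 b≢0) (trans (sym (ιℤ-homo-* a b)) (cong ιℤ eq))

^-≢0 : ∀ {z} n → z ≢ + 0 → z ℤ.^ n ≢ + 0
^-≢0 zero    z≢0 ()
^-≢0 (suc n) z≢0 = ℤ-*-≢0 z≢0 (^-≢0 n z≢0)

multiple-integerˡ : ∀ a b {q} → IsInteger (ιℤ b * q) → IsInteger (ιℤ (a ℤ.* b) * q)
multiple-integerˡ a b {q} int = subst IsInteger (trans (sym (ℚₚ.*-assoc (ιℤ a) (ιℤ b) q)) (cong (_* q) (sym (ιℤ-homo-* a b)))) (*-integer (ιℤ-integer a) int)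

multiple-integerʳ : ∀ a b {q} → IsInteger (ιℤ a * q) → IsInteger (ιℤ (a ℤ.* b) * q)
multiple-integerʳ a b {q} int = subst (λ z → IsInteger (ιℤ z * q)) (ℤₚ.*-comm b a) (multiple-integerˡ b a int)

*0-integer : ∀ a → IsInteger (a * 0ℚ)
*0-integer a = subst IsInteger (sym (ℚₚ.*-zeroʳ a)) 0-integer

common-denominator : ∀ p → ∃ λ b → b ≢ + 0 × (∀ n → IsInteger (ιℤ b * polyPS p n))
common-denominator []       = + 1 , (λ ()) , λ n → *0-integer 1ℚ
common-denominator (c ∷ cs) with common-denominator cs
... | b , b≢0 , int = ↧ c ℤ.* b , ℤ-*-≢0 {↧ c} (λ ()) b≢0 , λ
  { zero    → multiple-integerʳ (↧ c) b (↥ c , clear-denominator c)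
  ; (suc n) → multiple-integerˡ (↧ c) b (int n) }

common-denominator₂ : ∀ P → ∃ λ b → b ≢ + 0 × (∀ i j → IsInteger (ιℤ b * poly₂PS P i j))
common-denominator₂ []       = + 1 , (λ ()) , λ i j → *0-integer 1ℚ
common-denominator₂ (p ∷ ps) with common-denominator p | common-denominator₂ ps
... | a , a≢0 , int-p | b , b≢0 , int-ps = a ℤ.* b , ℤ-*-≢0 a≢0 b≢0 , λ
  { zero    j → multiple-integerʳ a b (int-p j)
  ; (suc i) j → multiple-integerˡ a b (int-ps i j) }

lowest : ∀ p → (∀ n → polyPS p n ≡ 0ℚ) ⊎ ∃ λ j → polyPS p j ≢ 0ℚ × (∀ k → k ℕ.< j → polyPS p k ≡ 0ℚ)
lowest [] = inj₁ λ n → refl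
lowest (c ∷ cs) with c ≟ 0ℚ
... | no c≢0 = inj₂ (0 , c≢0 , λ k ())
... | yes c≡0 with lowest cs
...   | inj₁ cs≡0 = inj₁ λ { zero → c≡0 ; (suc n) → cs≡0 n }
...   | inj₂ (j , csj≢0 , below) = inj₂ (suc j , csj≢0 , λ { zero _ → c≡0 ; (suc k) (s≤s k<j) → below k k<j })

LowestTerm : PowerSeries₂ → ℕ → ℕ → Set
LowestTerm A i j = A i j ≢ 0ℚ × (∀ k l → k ℕ.< i → A k l ≡ 0ℚ) × (∀ l → l ℕ.< j → A i l ≡ 0ℚ)

lowest₂ : ∀ P → (∀ i j → poly₂PS P i j ≡ 0ℚ) ⊎ ∃₂ (LowestTerm (poly₂PS P))
lowest₂ [] = inj₁ λ i j → refl
lowest₂ (p ∷ ps) with lowest p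
... | inj₂ (j , pj≢0 , below) = inj₂ (0 , j , pj≢0 , (λ k l ()) , below)
... | inj₁ p≡0 with lowest₂ ps
...   | inj₁ ps≡0 = inj₁ λ { zero → p≡0 ; (suc i) → ps≡0 i }
...   | inj₂ (i , j , c≢0 , rows , below) = inj₂ (suc i , j , c≢0 , (λ { zero l _ → p≡0 l ; (suc k) l (s≤s k<i) → rows k l k<i }) , below)

poly₂PS-row : ∀ P i j → poly₂PS P i j ≡ polyPS (row P i) j
poly₂PS-row []       i       j = refl
poly₂PS-row (p ∷ ps) zero    j = refl
poly₂PS-row (p ∷ ps) (suc i) j = poly₂PS-row ps i j

nonzero⇒lowestTerm : ∀ P → NonzeroPoly₂ P → ∃₂ (LowestTerm (poly₂PS P))
nonzero⇒lowestTerm P nz with lowest₂ P | nonzeroPoly₂⇒row≢0 nz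
... | inj₂ found | _ = found
... | inj₁ P≡0   | i , n , _ , c≢0 = contradiction (trans (sym (poly₂PS-row P i n)) (P≡0 i n)) c≢0

-- Solving Q R = P for the coefficient of R facing the lexicographically lowest term (i₀ , j₀) of Q
-- involves only coefficients of R of smaller weight b + (j₀ + 1) a, even if Q vanishes at the origin.
module _ (Q P R : PowerSeries₂) (QR≡P : ∀ i j → (Q ⊛₂ R) i j ≡ P i j)
         (Q-integer : ∀ i j → IsInteger (Q i j)) (P-integer : ∀ i j → IsInteger (P i j))
         {i₀ j₀ : ℕ} (low : LowestTerm Q i₀ j₀) where
  private
    c = Q i₀ j₀

    c-pow-integer : ∀ n → IsInteger (pow c n)
    c-pow-integer n with Q-integer i₀ j₀
    ... | z , eq = subst (λ x → IsInteger (pow x n)) (sym eq) (pow-integer z n)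

  -- A term of Q in a later row lowers a by at least one but may raise b by up to j₀; the factor j₀
  -- + 1 on a makes the total drop nevertheless.
  weight : ℕ → ℕ → ℕ
  weight a b = b ℕ.+ suc j₀ ℕ.* a

  -- Solving for one coefficient costs a single division by `c` and refers only to strictly smaller
  -- weights, so weight + 1 divisions suffice.
  quotient-denominators : ∀ a b → IsInteger (pow c (suc (weight a b)) * R a b)
  quotient-denominators a b = go (suc (weight a b)) a b ℕₚ.≤-refl
    where
    go : ∀ W a b → weight a b ℕ.< W → IsInteger (pow c (suc (weight a b)) * R a b)
    go (suc W) a b (s≤s w≤W) = subst IsInteger
      (trans (cong₂ (λ i j → pow c w * (c * R i j)) (ℕₚ.m+n∸m≡n i₀ a) (ℕₚ.m+n∸m≡n j₀ b))
        (solve 3 (λ p c r → p :* (c :* r) := (c :* p) :* r) refl (pow c w) c (R a b)))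
      isolated
      where
      open ℚ-Solver
      w = weight a b
      I = i₀ ℕ.+ a
      J = j₀ ℕ.+ b
      term : ℕ → ℕ → ℚ
      term k l = pow c w * (Q k l * R (I ∸ k) (J ∸ l))
      lighter : ∀ q a′ b′ → IsInteger q → weight a′ b′ ℕ.< w → IsInteger (pow c w * (q * R a′ b′))
      lighter q a′ b′ q-int w′<w = subst IsInteger (begin
        q * (pow c (w ∸ suc w′) * (pow c (suc w′) * R a′ b′))
          ≡⟨ solve 4 (λ q x y r → q :* (x :* (y :* r)) := (x :* y) :* (q :* r)) refl q (pow c (w ∸ suc w′)) (pow c (suc w′)) (R a′ b′) ⟩
        (pow c (w ∸ suc w′) * pow c (suc w′)) * (q * R a′ b′)
          ≡⟨ cong (_* (q * R a′ b′)) (trans (sym (pow-+ c (w ∸ suc w′) (suc w′))) (cong (pow c) (ℕₚ.m∸n+n≡m w′<w))) ⟩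
        pow c w * (q * R a′ b′) ∎)
        (*-integer q-int (*-integer (c-pow-integer (w ∸ suc w′)) (go W a′ b′ (ℕₚ.<-≤-trans w′<w w≤W))))
        where
        open ≡-Reasoning
        w′ = weight a′ b′
      vanishing : ∀ {q} r → q ≡ 0ℚ → IsInteger (pow c w * (q * r))
      vanishing r q≡0 = subst IsInteger (sym (trans (cong (_*_ (pow c w)) (trans (cong (_* r) q≡0) (ℚₚ.*-zeroˡ r))) (ℚₚ.*-zeroʳ (pow c w)))) 0-integer
      other-row : ∀ k l → k ℕ.≤ I → k ≢ i₀ → IsInteger (term k l)
      other-row k l k≤I k≢i₀ with ℕₚ.<-cmp k i₀
      ... | tri< k<i₀ _ _ = vanishing _ (proj₁ (proj₂ low) k l k<i₀)
      ... | tri≈ _ k≡i₀ _ = contradiction k≡i₀ k≢i₀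
      ... | tri> _ _ i₀<k = lighter (Q k l) (I ∸ k) (J ∸ l) (Q-integer k l) (begin-strict
        (J ∸ l) ℕ.+ suc j₀ ℕ.* (I ∸ k)        ≤⟨ ℕₚ.+-monoˡ-≤ (suc j₀ ℕ.* (I ∸ k)) (ℕₚ.m∸n≤m J l) ⟩
        j₀ ℕ.+ b ℕ.+ suc j₀ ℕ.* (I ∸ k)       ≡⟨ cong (ℕ._+ suc j₀ ℕ.* (I ∸ k)) (ℕₚ.+-comm j₀ b) ⟩
        b ℕ.+ j₀ ℕ.+ suc j₀ ℕ.* (I ∸ k)       ≡⟨ ℕₚ.+-assoc b j₀ _ ⟩
        b ℕ.+ (j₀ ℕ.+ suc j₀ ℕ.* (I ∸ k))     <⟨ ℕₚ.+-monoʳ-< b (ℕₚ.n<1+n _) ⟩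
        b ℕ.+ (suc j₀ ℕ.+ suc j₀ ℕ.* (I ∸ k)) ≡⟨ cong (b ℕ.+_) (ℕₚ.*-suc (suc j₀) (I ∸ k)) ⟨
        b ℕ.+ suc j₀ ℕ.* suc (I ∸ k)          ≤⟨ ℕₚ.+-monoʳ-≤ b (ℕₚ.*-monoʳ-≤ (suc j₀) I∸k<a) ⟩
        b ℕ.+ suc j₀ ℕ.* a                    ∎)
        where
        open ℕₚ.≤-Reasoning
        I∸k<a : I ∸ k ℕ.< a
        I∸k<a = subst (I ∸ k ℕ.<_) (ℕₚ.m+n∸m≡n i₀ a) (ℕₚ.∸-monoʳ-< i₀<k k≤I)
      same-row : ∀ l → l ℕ.≤ J → l ≢ j₀ → IsInteger (term i₀ l)
      same-row l l≤J l≢j₀ with ℕₚ.<-cmp l j₀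
      ... | tri< l<j₀ _ _ = vanishing _ (proj₂ (proj₂ low) l l<j₀)
      ... | tri≈ _ l≡j₀ _ = contradiction l≡j₀ l≢j₀
      ... | tri> _ _ j₀<l = lighter (Q i₀ l) (I ∸ i₀) (J ∸ l) (Q-integer i₀ l)
        (ℕₚ.+-mono-<-≤ (subst (J ∸ l ℕ.<_) (ℕₚ.m+n∸m≡n j₀ b) (ℕₚ.∸-monoʳ-< j₀<l l≤J)) (ℕₚ.≤-reflexive (cong (suc j₀ ℕ.*_) (ℕₚ.m+n∸m≡n i₀ a))))
      total : IsInteger (sumTo (λ k → sumTo (term k) J) I)
      total = subst IsInteger
        (trans (cong (_*_ (pow c w)) (sym (QR≡P I J))) (trans (sym (sumTo-*ˡ (pow c w) _ I)) (sumTo-cong I λ k _ → sym (sumTo-*ˡ (pow c w) _ J))))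
        (*-integer (c-pow-integer w) (P-integer I J))
      isolated : IsInteger (term i₀ j₀)
      isolated = sumTo-isolate (term i₀) J j₀ (ℕₚ.m≤m+n j₀ b)
        (sumTo-isolate (λ k → sumTo (term k) J) I i₀ (ℕₚ.m≤m+n i₀ a) total (λ k k≤I k≢i₀ → sumTo-integer (term k) J λ l _ → other-row k l k≤I k≢i₀))
        same-row

diagonal⇒almostIntegral : ∀ f → DiagonalOfRational₂ f → AlmostIntegral f
diagonal⇒almostIntegral f (P , Q , R , Q≢0 , QR≡P , diag) with nonzero⇒lowestTerm Q Q≢0 | common-denominator₂ Q | common-denominator₂ P
... | i₀ , j₀ , q≢0 , rows , below | a , a≢0 , Q-int | b , b≢0 , P-int
  with multiple-integerʳ a b (Q-int i₀ j₀)
-- At (n+1, n+1) the weight is (j₀ + 2) (n + 1), which calls for one more power of q than that.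
-- Multiplying by a further qⁿ gives the exponent (j₀ + 3) (n + 1), hence the base C^(3 + j₀).
... | C , ιNq≡ιC = C ℤ.^ (3 ℕ.+ j₀) , ^-≢0 (3 ℕ.+ j₀) C≢0 , λ n → subst IsInteger (begin
    pow q n * (pow q (suc (diagonalWeight n)) * R (suc n) (suc n))
      ≡⟨ ℚₚ.*-assoc (pow q n) _ _ ⟨
    pow q n * pow q (suc (diagonalWeight n)) * R (suc n) (suc n)
      ≡⟨ cong₂ _*_ (trans (sym (pow-+ q n (suc (diagonalWeight n)))) (trans (cong (pow q) (ℕₚ.+-suc n (diagonalWeight n))) (pow-* q (3 ℕ.+ j₀) (suc n)))) (diag (suc n)) ⟩
    pow (pow q (3 ℕ.+ j₀)) (suc n) * f (suc n)
      ≡⟨ cong (λ x → pow x (suc n) * f (suc n)) (trans (cong (λ x → pow x (3 ℕ.+ j₀)) ιNq≡ιC) (pow-ιℤ C (3 ℕ.+ j₀))) ⟩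
    pow (ιℤ (C ℤ.^ (3 ℕ.+ j₀))) (suc n) * f (suc n) ∎)
    (*-integer (subst (λ x → IsInteger (pow x n)) (sym ιNq≡ιC) (pow-integer C n))
      (quotient-denominators (λ i j → N * poly₂PS Q i j) (λ i j → N * poly₂PS P i j) R NQ·R≡NP
        (λ i j → multiple-integerʳ a b (Q-int i j)) (λ i j → multiple-integerˡ a b (P-int i j)) low (suc n) (suc n)))
  where
  open ≡-Reasoning
  N = ιℤ (a ℤ.* b)
  N≢0 : N ≢ 0ℚ
  N≢0 = ιℤ-≢0 (ℤ-*-≢0 a≢0 b≢0)
  q = N * poly₂PS Q i₀ j₀
  diagonalWeight : ℕ → ℕ
  diagonalWeight n = suc n ℕ.+ suc j₀ ℕ.* suc n
  C≢0 : C ≢ + 0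
  C≢0 eq = *-≢0 N≢0 q≢0 (trans ιNq≡ιC (cong ιℤ eq))
  low : LowestTerm (λ i j → N * poly₂PS Q i j) i₀ j₀
  low = *-≢0 N≢0 q≢0 , (λ k l k<i → trans (cong (_*_ N) (rows k l k<i)) (ℚₚ.*-zeroʳ N)) , (λ l l<j → trans (cong (_*_ N) (below l l<j)) (ℚₚ.*-zeroʳ N))
  NQ·R≡NP : ∀ i j → ((λ i j → N * poly₂PS Q i j) ⊛₂ R) i j ≡ N * poly₂PS P i j
  NQ·R≡NP i j = trans
    (sumTo-cong i λ k _ → trans (sumTo-cong j λ l _ → ℚₚ.*-assoc N _ _) (sumTo-*ˡ N _ j))
    (trans (sumTo-*ˡ N _ i) (cong (_*_ N) (QR≡P i j)))

-- The Casorati determinant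

pow-distrib-* : ∀ p q n → pow (p * q) n ≡ pow p n * pow q n
pow-distrib-* p q zero    = refl
pow-distrib-* p q (suc n) = trans (cong (_*_ (p * q)) (pow-distrib-* p q n))
  (solve 4 (λ p q a b → (p :* q) :* (a :* b) := (p :* a) :* (q :* b)) refl p q (pow p n) (pow q n))
  where open ℚ-Solver

-- One step of the recurrence multiplies the determinant by -(3k + 3) / (k + 4). The product of
-- these factors telescopes to 6 (-3)ᵏ / ((k+1) (k+2) (k+3)).
casoratian : ∀ f g → Recurrence f → Recurrence g → ∀ k →
  (ιℕ 1 + ιℕ k) * (ιℕ 2 + ιℕ k) * (ιℕ 3 + ιℕ k) * (f (suc k) * g k - f k * g (suc k))
  ≡ ιℕ 6 * pow (ιℤ -[1+ 2 ]) k * (f 1 * g 0 - f 0 * g 1)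
casoratian f g rf rg zero    = refl
casoratian f g rf rg (suc k) = begin
  (ιℕ 1 + ιℕ (suc k)) * (ιℕ 2 + ιℕ (suc k)) * (ιℕ 3 + ιℕ (suc k)) * (f₂ * g₁ - f₁ * g₂)
    ≡⟨ cong (λ x → (ιℕ 1 + x) * (ιℕ 2 + x) * (ιℕ 3 + x) * (f₂ * g₁ - f₁ * g₂)) (ιℕ-suc k) ⟩
  (ιℕ 1 + (1ℚ + x)) * (ιℕ 2 + (1ℚ + x)) * (ιℕ 3 + (1ℚ + x)) * (f₂ * g₁ - f₁ * g₂)
    ≡⟨ solve 5 (λ x f₁ f₂ g₁ g₂ → (con (+ 1) :+ (con (+ 1) :+ x)) :* (con (+ 2) :+ (con (+ 1) :+ x)) :* (con (+ 3) :+ (con (+ 1) :+ x)) :* (f₂ :* g₁ :- f₁ :* g₂)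
         := (con (+ 2) :+ x) :* (con (+ 3) :+ x) :* (((con (+ 4) :+ x) :* f₂) :* g₁ :- f₁ :* ((con (+ 4) :+ x) :* g₂))) refl x f₁ f₂ g₁ g₂ ⟩
  (ιℕ 2 + x) * (ιℕ 3 + x) * ((ιℕ 4 + x) * f₂ * g₁ - f₁ * ((ιℕ 4 + x) * g₂))
    ≡⟨ cong₂ (λ a b → (ιℕ 2 + x) * (ιℕ 3 + x) * (a * g₁ - f₁ * b)) (rf k) (rg k) ⟩
  (ιℕ 2 + x) * (ιℕ 3 + x) * (((ιℕ 5 + ιℕ 2 * x) * f₁ + (ιℕ 3 + ιℕ 3 * x) * f₀) * g₁ - f₁ * ((ιℕ 5 + ιℕ 2 * x) * g₁ + (ιℕ 3 + ιℕ 3 * x) * g₀))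
    ≡⟨ solve 5 (λ x f₀ f₁ g₀ g₁ → (con (+ 2) :+ x) :* (con (+ 3) :+ x)
           :* (((con (+ 5) :+ con (+ 2) :* x) :* f₁ :+ (con (+ 3) :+ con (+ 3) :* x) :* f₀) :* g₁ :- f₁ :* ((con (+ 5) :+ con (+ 2) :* x) :* g₁ :+ (con (+ 3) :+ con (+ 3) :* x) :* g₀))
         := con -[1+ 2 ] :* ((con (+ 1) :+ x) :* (con (+ 2) :+ x) :* (con (+ 3) :+ x) :* (f₁ :* g₀ :- f₀ :* g₁))) refl x f₀ f₁ g₀ g₁ ⟩
  ιℤ -[1+ 2 ] * ((ιℕ 1 + x) * (ιℕ 2 + x) * (ιℕ 3 + x) * (f₁ * g₀ - f₀ * g₁))
    ≡⟨ cong (_*_ (ιℤ -[1+ 2 ])) (casoratian f g rf rg k) ⟩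
  ιℤ -[1+ 2 ] * (ιℕ 6 * pow (ιℤ -[1+ 2 ]) k * (f 1 * g 0 - f 0 * g 1))
    ≡⟨ solve 2 (λ p d → con -[1+ 2 ] :* (con (+ 6) :* p :* d) := con (+ 6) :* (con -[1+ 2 ] :* p) :* d) refl (pow (ιℤ -[1+ 2 ]) k) (f 1 * g 0 - f 0 * g 1) ⟩
  ιℕ 6 * pow (ιℤ -[1+ 2 ]) (suc k) * (f 1 * g 0 - f 0 * g 1) ∎
  where
  open ≡-Reasoning
  open ℚ-Solver
  x  = ιℕ k
  f₀ = f k
  f₁ = f (suc k)
  f₂ = f (2 ℕ.+ k)
  g₀ = g k
  g₁ = g (suc k)
  g₂ = g (2 ℕ.+ k)

-- Consecutive numbers are coprime, so the factors h can be cancelled one by one until h + 1 would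
-- have to divide 1.
suc∤pow : ∀ h n → 1 ℕ.≤ h → ¬ suc h ∣ h ℕ.^ n
suc∤pow h zero    1≤h d = ℕₚ.<⇒≢ 1≤h (sym (ℕₚ.suc-injective (∣1⇒≡1 d)))
suc∤pow h (suc n) 1≤h d = suc∤pow h n 1≤h (coprime-divisor (subst (λ i → Coprime i h) (ℕₚ.+-comm h 1) (coprime-+ (1-coprimeTo h))) d)

abs-^ : ∀ z n → ℤ.∣ z ℤ.^ n ∣ ≡ ℤ.∣ z ∣ ℕ.^ n
abs-^ z zero    = refl
abs-^ z (suc n) = trans (ℤₚ.abs-* z (z ℤ.^ n)) (cong (ℤ.∣ z ∣ ℕ.*_) (abs-^ z n))

pow-not-divisible : ∀ z n y → z ≢ + 0 → ιℕ (suc ℤ.∣ z ∣) * ιℤ y ≢ pow (ιℤ z) n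
pow-not-divisible z n y z≢0 eq = suc∤pow ℤ.∣ z ∣ n (ℕₚ.n≢0⇒n>0 (λ ∣z∣≡0 → z≢0 (ℤₚ.∣i∣≡0⇒i≡0 ∣z∣≡0)))
  (divides ℤ.∣ y ∣ (begin
    ℤ.∣ z ∣ ℕ.^ n                    ≡⟨ abs-^ z n ⟨
    ℤ.∣ z ℤ.^ n ∣                    ≡⟨ cong ℤ.∣_∣ (ιℤ-injective {+ suc ℤ.∣ z ∣ ℤ.* y} {z ℤ.^ n} (trans (ιℤ-homo-* (+ suc ℤ.∣ z ∣) y) (trans eq (pow-ιℤ z n)))) ⟨
    ℤ.∣ + suc ℤ.∣ z ∣ ℤ.* y ∣        ≡⟨ ℤₚ.abs-* (+ suc ℤ.∣ z ∣) y ⟩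
    suc ℤ.∣ z ∣ ℕ.* ℤ.∣ y ∣          ≡⟨ ℕₚ.*-comm (suc ℤ.∣ z ∣) ℤ.∣ y ∣ ⟩
    ℤ.∣ y ∣ ℕ.* suc ℤ.∣ z ∣          ∎))
  where open ≡-Reasoning

integer-combination : ∀ {d u v m₁ M₀ c m₀ M₁ r} → IsInteger d → IsInteger u → IsInteger v → IsInteger m₁ → IsInteger M₀ →
  IsInteger c → IsInteger m₀ → IsInteger M₁ → IsInteger r → IsInteger (d * (u * v * (m₁ * M₀ - c * m₀ * M₁)) * r)
integer-combination d u v m₁ M₀ c m₀ M₁ r =
  *-integer (*-integer d (*-integer (*-integer u v) (+-integer (*-integer m₁ M₀) (neg-integer (*-integer (*-integer c m₀) M₁))))) r

-- Let δ be the Casorati determinant at 0 and z = 6 C (numerator of δ). The index n = |z| + 1 is coprime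
-- to z, while Cⁿ times the Casorati determinant at n shows that n divides a power of z.
module _ (m M : PowerSeries) (m-rec : Recurrence m) (M-rec : Recurrence M) (M-integer : ∀ n → IsInteger (M n))
         (C : ℤ) (C≢0 : C ≢ + 0) (m-integer : ∀ n → IsInteger (pow (ιℤ C) (suc n) * m (suc n)))
         (δ : ℚ) (δ-def : m 1 * M 0 - m 0 * M 1 ≡ δ) where
  private
    num = ιℤ (↥ δ)
    den = ιℤ (↧ δ)
    c = ιℤ C
    z = + 6 ℤ.* C ℤ.* ↥ δ

    ιz : ιℤ z ≡ ιℕ 6 * c * num
    ιz = trans (ιℤ-homo-* (+ 6 ℤ.* C) (↥ δ)) (cong (_* num) (ιℤ-homo-* (+ 6) C))

    -- An integral expression for z^(k+1) / (k+1): the powers of `c` clear the terms of m, `den`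
    -- clears δ, and (-2)ᵏ turns the (-3)ᵏ of the determinant into 6ᵏ, which with numᵏ completes the
    -- power of z.
    Y : ℕ → ℚ
    Y k = den * ((ιℕ 2 + ιℕ k) * (ιℕ 3 + ιℕ k) * (pow c (suc k) * m (suc k) * M k - c * (pow c k * m k) * M (suc k)))
          * (pow (ιℤ -[1+ 1 ]) k * pow num k)

    -- `Y 0` would involve m 0 itself, whose denominator almost integrality does not control; hence
    -- the shifted index.
    Y-integer : ∀ k → IsInteger (Y (suc k))
    Y-integer k = integer-combination {den} {ιℕ 2 + ιℕ (suc k)} {ιℕ 3 + ιℕ (suc k)} {pow c (2 ℕ.+ k) * m (2 ℕ.+ k)} {M (suc k)}
      {c} {pow c (suc k) * m (suc k)} {M (2 ℕ.+ k)} {pow (ιℤ -[1+ 1 ]) (suc k) * pow num (suc k)}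
      (ιℤ-integer (↧ δ))
      (+-integer (ιℤ-integer (+ 2)) (ιℤ-integer (+ suc k)))
      (+-integer (ιℤ-integer (+ 3)) (ιℤ-integer (+ suc k)))
      (m-integer (suc k)) (M-integer (suc k)) (ιℤ-integer C) (m-integer k) (M-integer (2 ℕ.+ k))
      (*-integer (pow-integer -[1+ 1 ] (suc k)) (pow-integer (↥ δ) (suc k)))

    nY : ∀ k → ιℕ (suc k) * Y k ≡ pow (ιℤ z) (suc k)
    nY k = begin
      ιℕ (suc k) * Y k
        ≡⟨ cong (_* Y k) (ιℕ-suc k) ⟩
      (ιℕ 1 + ιℕ k) * Y k
        ≡⟨ cong (λ e → (ιℕ 1 + ιℕ k) * (den * ((ιℕ 2 + ιℕ k) * (ιℕ 3 + ιℕ k) * e) * r))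
             (solve 6 (λ c p a b u v → c :* p :* a :* b :- c :* (p :* u) :* v := c :* p :* (a :* b :- u :* v)) refl c (pow c k) (m (suc k)) (M k) (m k) (M (suc k))) ⟩
      (ιℕ 1 + ιℕ k) * (den * ((ιℕ 2 + ιℕ k) * (ιℕ 3 + ιℕ k) * (c * pow c k * Δ)) * r)
        ≡⟨ solve 7 (λ x y z d e r Δ → x :* (d :* (y :* z :* (e :* Δ)) :* r) := d :* e :* r :* (x :* y :* z :* Δ)) refl
             (ιℕ 1 + ιℕ k) (ιℕ 2 + ιℕ k) (ιℕ 3 + ιℕ k) den (c * pow c k) r Δ ⟩
      den * (c * pow c k) * r * ((ιℕ 1 + ιℕ k) * (ιℕ 2 + ιℕ k) * (ιℕ 3 + ιℕ k) * Δ)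
        ≡⟨ cong (_*_ (den * (c * pow c k) * r)) (trans (casoratian m M m-rec M-rec k) (cong (_*_ (ιℕ 6 * pow (ιℤ -[1+ 2 ]) k)) δ-def)) ⟩
      den * (c * pow c k) * r * (ιℕ 6 * pow (ιℤ -[1+ 2 ]) k * δ)
        ≡⟨ solve 8 (λ i d δ c p t n s → d :* (c :* p) :* (t :* n) :* (i :* s :* δ) := i :* c :* (d :* δ) :* ((s :* t) :* p :* n)) refl
             (ιℕ 6) den δ c (pow c k) (pow (ιℤ -[1+ 1 ]) k) (pow num k) (pow (ιℤ -[1+ 2 ]) k) ⟩
      ιℕ 6 * c * (den * δ) * ((pow (ιℤ -[1+ 2 ]) k * pow (ιℤ -[1+ 1 ]) k) * pow c k * pow num k)
        ≡⟨ cong₂ (λ x y → ιℕ 6 * c * x * (y * pow c k * pow num k)) (clear-denominator δ) (sym (pow-distrib-* (ιℤ -[1+ 2 ]) (ιℤ -[1+ 1 ]) k)) ⟩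
      ιℕ 6 * c * num * (pow (ιℕ 6) k * pow c k * pow num k)
        ≡⟨ cong (_*_ (ιℕ 6 * c * num)) (trans (cong (_* pow num k) (sym (pow-distrib-* (ιℕ 6) c k))) (sym (pow-distrib-* (ιℕ 6 * c) num k))) ⟩
      pow (ιℕ 6 * c * num) (suc k)
        ≡⟨ cong (λ x → pow x (suc k)) ιz ⟨
      pow (ιℤ z) (suc k) ∎
      where
      open ≡-Reasoning
      open ℚ-Solver
      r = pow (ιℤ -[1+ 1 ]) k * pow num k
      Δ = m (suc k) * M k - m k * M (suc k)

  casoratian-vanishes : δ ≡ 0ℚ
  casoratian-vanishes = decidable-stable (δ ≟ 0ℚ) λ δ≢0 → go (z≢0 δ≢0) ℤ.∣ z ∣ refl
    where
    z≢0 : δ ≢ 0ℚ → z ≢ + 0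
    z≢0 δ≢0 eq = *-≢0 (*-≢0 (ιℕ-suc≢0 5) (ιℤ-≢0 C≢0)) (ιℤ-≢0 {↥ δ} λ eq → δ≢0 (ℚₚ.↥p≡0⇒p≡0 δ eq)) (trans (sym ιz) (cong ιℤ eq))
    go : z ≢ + 0 → ∀ h → ℤ.∣ z ∣ ≢ h
    go z≢0 zero    eq = z≢0 (ℤₚ.∣i∣≡0⇒i≡0 eq)
    go z≢0 (suc k) eq with Y-integer k
    ... | y , Y≡y = pow-not-divisible z (2 ℕ.+ k) y z≢0 (trans (cong₂ (λ h Y → ιℕ (suc h) * Y) eq (sym Y≡y)) (nY (suc k)))

-- The comparison solution is the Motzkin sequence: it is integral and starts with 1, 1, so the
-- determinant at 0 is exactly m₁ - m₀.
almostIntegral⇒≡ : ∀ m₀ m₁ → AlmostIntegral (seqM m₀ m₁) → m₀ ≡ m₁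
almostIntegral⇒≡ m₀ m₁ (C , C≢0 , integral) = sym (ℚ-Group.x∙y⁻¹≈ε⇒x≈y m₁ m₀
  (casoratian-vanishes (seqM m₀ m₁) (seqM 1ℚ 1ℚ) (seqM-recurrence m₀ m₁) (seqM-recurrence 1ℚ 1ℚ) M-integer C C≢0 integral
    (m₁ - m₀) (cong₂ _-_ (ℚₚ.*-identityʳ m₁) (ℚₚ.*-identityʳ m₀))))
  where
  M-integer : ∀ n → IsInteger (seqM 1ℚ 1ℚ n)
  M-integer n = subst IsInteger (sym (trans (seqM≡motzkin 1ℚ n) (ℚₚ.*-identityˡ _))) (ιℤ-integer (motzkin n))

boundedDenominator⇒almostIntegral : ∀ f → (Σ ℤ λ b → b ≢ + 0 × (∀ n → IsInteger (ιℤ b * f n))) → AlmostIntegral f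
boundedDenominator⇒almostIntegral f (b , b≢0 , int) = b , b≢0 , λ n → subst IsInteger
  (trans (sym (ℚₚ.*-assoc (pow (ιℤ b) n) (ιℤ b) _)) (cong (_* f (suc n)) (ℚₚ.*-comm (pow (ιℤ b) n) (ιℤ b))))
  (*-integer (pow-integer b n) (int (suc n)))

theorem3p1 : (m₀ m₁ : ℚ) →
    (Algebraic (seqM m₀ m₁) ⇔ (m₀ ≡ m₁)) ×
    (GloballyBounded (seqM m₀ m₁) ⇔ (m₀ ≡ m₁)) ×
    ((Σ ℤ λ b → b ≢ + 0 × (∀ n → IsInteger (ιℤ b * seqM m₀ m₁ n))) ⇔ (m₀ ≡ m₁)) ×
    (DiagonalOfRational₂ (seqM m₀ m₁) ⇔ (m₀ ≡ m₁))
theorem3p1 m₀ m₁ =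
  mk⇔ (algebraic⇒≡ m₀ m₁) (λ { refl → seqM-algebraic m₀ }) ,
  mk⇔ (λ bounded → almostIntegral⇒≡ m₀ m₁ (proj₁ bounded))
      (λ { refl → boundedDenominator⇒almostIntegral (seqM m₀ m₀) (seqM-bounded-denominator m₀) , seqM-positiveRadius m₀ }) ,
  mk⇔ (λ bounded → almostIntegral⇒≡ m₀ m₁ (boundedDenominator⇒almostIntegral (seqM m₀ m₁) bounded)) (λ { refl → seqM-bounded-denominator m₀ }) ,
  mk⇔ (λ diag → almostIntegral⇒≡ m₀ m₁ (diagonal⇒almostIntegral (seqM m₀ m₁) diag)) (λ { refl → seqM-diagonal m₀ })
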